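{- The map $\beta:\mathcal{T}\to\mathcal{M}$ and its inverse map $\bar\beta:\mathcal{M}\to\mathcal{T}$ are size-preserving bijections between Fishburn trees and Fishburn matrices. In particular, for each $n\ge1$ we have $|\mathcal{T}_n|=|\mathcal{M}_n|$.
   Context: Write $[k]=\{1,\dots,k\}$. A binary tree is either empty or a triple $T=(L,r,R)$ with $r$ a node (the root) and $L,R$ binary trees (left and right subtree). $V(T)$ is the set of nodes and the size of $T$ is $|V(T)|$. A vertex labeling is a map $\mathfrak{l}:V(T)\to\{1,2,\dots\}$; $\max(T)$ is the largest label, with $\max(\emptyset)=0$. Labeled binary trees are considered up to label-preserving isomorphism of binary trees. $T$ is decreasing if it is empty, or $T=(L,r,R)$ with $L,R$ decreasing and $\mathfrak{l}(r)\ge\max\{\max(L),\max(R)\}$. $T$ is strictly decreasing to the left if it is empty, or $T=(L,r,R)$ with $\mathfrak{l}(r)>\max(L)$ and $L,R$ strictly decreasing to the left. An endotree of size $n$ is a decreasing binary tree of size $n$ that is strictly decreasing to the left and has all labels in $[n]$; it is regular if the set of its labels equals $[k]$ for some $k\le n$. The in-order traversal of $T=(L,r,R)$ traverses $L$ recursively, then visits $r$, then traverses $R$ recursively; $v_i$ is the $i$-th visited node. Put $\mathrm{asctops}(T)=\{v_1\}\cup\{v_i: v_i\text{ has a left child}\}$ and $\mathrm{nub}(T)=\{v_j:\mathfrak{l}(v_i)\ne\mathfrak{l}(v_j)\text{ for each }i<j\}$ (both empty for the empty tree). A Fishburn tree is a regular endotree $T$ with $\mathrm{nub}(T)=\mathrm{asctops}(T)$;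 $\mathcal{T}$ is the set of Fishburn trees and $\mathcal{T}_n$ the set of those of size $n$. A maximal right path is a nonempty sequence of nodes $(w_1,\dots,w_m)$ with $w_{i+1}$ the right child of $w_i$, where $w_1$ is not a right child of any node and $w_m$ has no right child; maximal left paths are defined analogously. $\mathrm{rpath}(v)$ and $\mathrm{lpath}(v)$ are the unique maximal right and left paths containing $v$. For nonempty $T$ with root $r$, $\mathrm{diag}(T)=\mathrm{lpath}(r)$ (viewed as a set; it is contained in $\mathrm{asctops}(T)$) and $\overline{\mathrm{diag}}(T)=\mathrm{asctops}(T)\setminus\mathrm{diag}(T)$. For a Fishburn tree $T$ with $k=\max(T)$, the set $\mathrm{asctops}(T)$ has exactly one node of each label $i\in[k]$. If $v\in\mathrm{asctops}(T)$ has label $i$, let $W_i=\mathrm{rpath}(v)$ if $v\in\mathrm{diag}(T)$, and $W_i=\mathrm{rpath}(\mathrm{lchild}(v))$ if $v\in\overline{\mathrm{diag}}(T)$, where $\mathrm{lchild}(v)$ is the left child of $v$; $W_1,\dots,W_k$ are exactly the maximal right paths of $T$. Let $B_i$ be the multiset $\{\mathfrak{l}(u):u\in W_i\}$ and $\mathfrak{P}(T)=B_1\dots B_k$. A Fishburn matrix is a lower triangular square matrix with nonnegative integer entries such that every row and every column contains at least one nonzero entry; its size is the sum of its entries. $\mathcal{M}$ is the set of Fishburn matrices (including the $0\times0$ matrix, corresponding to the empty tree) and $\mathcal{M}_n$ those of size $n$. For a Fishburn tree $T$ with $k=\max(T)$, $\beta(T)$ is the $k\times k$ matrix whose $(i,j)$-th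 entry is the number of nodes of label $j$ in $W_i$. For a $k\times k$ Fishburn matrix $A=(a_{i,j})$, let $B_i$ be the multiset containing exactly $a_{i,j}$ copies of $j$ for each $j\in[k]$; $\bar\beta(A)$ is the unique Fishburn tree $T$ with $\mathfrak{P}(T)=B_1\dots B_k$ (such a tree exists and is unique for every list of $k$ nonempty multisets whose elements form exactly the set $[k]$ and such that $j\in B_i$ implies $j\le i$). -}

module Defs where

open import Data.Fin as Fin using (Fin; toℕ)
open import Data.List as List
  using (List; []; _∷_; _++_; concat; filter; head; last; length; lookup; map; replicate)
open import Data.List.Membership.Propositional using (_∈_)
open import Data.List.Membership.Propositional.Properties using (∈-map⁺)
open import Data.List.Properties using (head-map; last-map)
import Data.List.Membership.DecPropositional as DecMembership
open import Data.List.Relation.Binary.Permutation.Propositional using (_↭_)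
open import Data.List.Relation.Binary.Pointwise using (Pointwise)
open import Data.List.Relation.Unary.Any using (here; there)
open import Data.List.Relation.Unary.Linked using (Linked; []; [-]; _∷_)
open import Data.Maybe as Maybe using (Maybe; just; nothing; maybe′)
open import Data.Maybe.Properties using (just-injective; map-injective) renaming (≡-dec to Maybe-≡-dec)
open import Data.Nat as ℕ using (ℕ; suc; _⊔_; _≤_; _≥_; _>_)
open import Data.Product using (Σ; Σ-syntax; ∃; ∃-syntax; _×_; _,_; proj₁; proj₂)
open import Data.Sum using (_⊎_; inj₁; inj₂)
open import Data.Tree.Binary using (Tree; leaf; node; #nodes)
open import Data.Unit using (⊤)
open import Data.Vec as Vec using (Vec)
open import Function using (Inverse; _∘_)
open import Relation.Binary using (Setoid; DecidableEquality)
import Relation.Binary.Construct.On as On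
open import Relation.Binary.PropositionalEquality as ≡
  using (_≡_; _≢_; refl; sym; trans; cong)
open import Relation.Nullary using (Dec; yes; no; does; contradiction)
open import Relation.Nullary.Decidable using (map′; _×-dec_; _⊎-dec_)
open import Relation.Unary using (Pred; Decidable; _≐_)
open import Data.Bool using (if_then_else_)
open import Level using (0ℓ)

-- Labels are natural numbers; IsEndotree makes them positive. Nodes have no identity
-- beyond their position, so propositional equality of trees is label-preserving
-- isomorphism.
LTree : Set
LTree = Tree ℕ ⊤

pattern empty = leaf _

data Node : LTree → Set where
  root  : ∀ {l m r} → Node (node l m r)
  left  : ∀ {l m r} → Node l → Node (node l m r)
  right : ∀ {l m r} → Node r → Node (node l m r)

label : ∀ {T} → Node T → ℕ
label (root {m = m}) = m
label (left v)       = label v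
label (right v)      = label v

maxLabel : LTree → ℕ
maxLabel empty        = 0
maxLabel (node l m r) = m ⊔ (maxLabel l ⊔ maxLabel r)

Decreasing : LTree → Set
Decreasing empty        = ⊤
Decreasing (node l m r) = Decreasing l × Decreasing r × m ≥ maxLabel l ⊔ maxLabel r

StrictlyDecreasingLeft : LTree → Set
StrictlyDecreasingLeft empty        = ⊤
StrictlyDecreasingLeft (node l m r) =
  m > maxLabel l × StrictlyDecreasingLeft l × StrictlyDecreasingLeft r

[1⋯_] : ℕ → Pred ℕ 0ℓ
[1⋯ k ] i = 1 ≤ i × i ≤ k

record IsEndotree (T : LTree) : Set where
  field
    decreasing     : Decreasing T
    strictlyLeft   : StrictlyDecreasingLeft T
    labelsInRange  : ∀ (v : Node T) → [1⋯ #nodes T ] (label v)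

Labels : LTree → Pred ℕ 0ℓ
Labels T i = ∃[ v ] label {T} v ≡ i

IsRegular : LTree → Set
IsRegular T = ∃[ k ] (k ≤ #nodes T × Labels T ≐ [1⋯ k ])

inorder : ∀ T → List (Node T)
inorder empty        = []
inorder (node l m r) = map left (inorder l) ++ root ∷ map right (inorder r)

rootOf : ∀ T → Maybe (Node T)
rootOf empty        = nothing
rootOf (node _ _ _) = just root

lchild : ∀ {T} → Node T → Maybe (Node T)
lchild (root {l = l}) = Maybe.map left (rootOf l)
lchild (left v)       = Maybe.map left (lchild v)
lchild (right v)      = Maybe.map right (lchild v)

rchild : ∀ {T} → Node T → Maybe (Node T)
rchild (root {r = r}) = Maybe.map right (rootOf r)
rchild (left v)       = Maybe.map left (rchild v)
rchild (right v)      = Maybe.map right (rchild v)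

asctops : ∀ T → Pred (Node T) 0ℓ
asctops T v = head (inorder T) ≡ just v ⊎ ∃[ u ] lchild v ≡ just u

nub : ∀ T → Pred (Node T) 0ℓ
nub T v = ∃[ j ] (lookup vs j ≡ v ×
                  (∀ i → i Fin.< j → label (lookup vs i) ≢ label (lookup vs j)))
  where vs = inorder T

record IsFishburnTree (T : LTree) : Set where
  field
    isEndotree  : IsEndotree T
    isRegular   : IsRegular T
    nub≐asctops : nub T ≐ asctops T

record IsMaximalPath {V : Set} (child : V → Maybe V) (ws : List V) : Set where
  field
    w₁ wₘ        : V
    head≡        : head ws ≡ just w₁
    last≡        : last ws ≡ just wₘ
    linked       : Linked (λ w w′ → child w ≡ just w′) ws
    w₁-not-child : ∀ u → child u ≢ just w₁
    wₘ-no-child  : child wₘ ≡ nothing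

-- The maximal right path starting at the root of T.
rspine : ∀ T → List (Node T)
rspine empty        = []
rspine (node _ _ r) = root ∷ map right (rspine r)

-- A maximal right path of the right subtree r, completed to one of the whole
-- tree: it acquires the new root exactly when it starts at the root of r.
extend : ∀ {l m r} → List (Node r) → List (Node (node l m r))
extend (root ∷ ws) = root ∷ map right (root ∷ ws)
extend ws          = map right ws

rpath : ∀ {T} → Node T → List (Node T)
rpath {T} root  = rspine T
rpath (left v)  = map left (rpath v)
rpath (right v) = extend (rpath v)

-- lpath of the root (diag-isMaximalPath).
diag : ∀ T → List (Node T)
diag empty        = []
diag (node l _ _) = root ∷ map left (diag l)

infix 4 _≟_
_≟_ : ∀ {T} → DecidableEquality (Node T)
root    ≟ root    = yes refl
root    ≟ left _  = no λ ()
root    ≟ right _ = no λ ()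
left _  ≟ root    = no λ ()
left u  ≟ left v  = map′ (cong left) (λ { refl → refl }) (u ≟ v)
left _  ≟ right _ = no λ ()
right _ ≟ root    = no λ ()
right _ ≟ left _  = no λ ()
right u ≟ right v = map′ (cong right) (λ { refl → refl }) (u ≟ v)

asctops? : ∀ T → Decidable (asctops T)
asctops? T v = Maybe-≡-dec _≟_ (head (inorder T)) (just v) ⊎-dec hasLeftChild
  where
  hasLeftChild : Dec (∃[ u ] lchild v ≡ just u)
  hasLeftChild with lchild v
  ... | just u  = yes (u , refl)
  ... | nothing = no λ ()

-- The path attached to an asctop v. The default [] is never used: in a Fishburn
-- tree the only asctop which may lack a left child is v₁, and v₁ lies on diag T.
attachedPath : ∀ {T} → Node T → List (Node T)
attachedPath {T} v =
  if does (v ∈? diag T) then rpath v else maybe′ rpath [] (lchild v)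
  where open DecMembership _≟_ using (_∈?_)

-- In a Fishburn tree with maximal label k, exactly one asctop has label i, for each
-- i in [1⋯ k ], so `head` selects that one; the default [] is only reached for
-- other trees or other i.
W : ∀ T → ℕ → List (Node T)
W T i = maybe′ attachedPath []
  (head (filter (λ v → asctops? T v ×-dec (label v ℕ.≟ i)) (inorder T)))

Matrix : ℕ → Set
Matrix k = Vec (Vec ℕ k) k

infixl 9 _⟨_,_⟩
_⟨_,_⟩ : ∀ {k} → Matrix k → Fin k → Fin k → ℕ
A ⟨ i , j ⟩ = Vec.lookup (Vec.lookup A i) j

record IsFishburnMatrix {k} (A : Matrix k) : Set where
  field
    lowerTriangular : ∀ i j → i Fin.< j → A ⟨ i , j ⟩ ≡ 0
    row≢0           : ∀ i → ∃[ j ] A ⟨ i , j ⟩ ≢ 0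
    column≢0        : ∀ j → ∃[ i ] A ⟨ i , j ⟩ ≢ 0

entrySum : ∀ {k} → Matrix k → ℕ
entrySum A = Vec.sum (Vec.map Vec.sum A)

-- Row and column indices i : Fin k stand for suc (toℕ i) in [1⋯ k ].
β : ∀ T → Matrix (maxLabel T)
β T = Vec.tabulate λ i → Vec.tabulate λ j →
  length (filter (λ u → label u ℕ.≟ suc (toℕ j)) (W T (suc (toℕ i))))

-- A multiset is a list up to permutation.
Multisets : Set
Multisets = List (List ℕ)

infix 4 _≋_
_≋_ : Multisets → Multisets → Set
_≋_ = Pointwise _↭_

𝔓 : LTree → Multisets
𝔓 T = List.tabulate {n = maxLabel T} λ i → map label (W T (suc (toℕ i)))

rowMultisets : ∀ {k} → Matrix k → Multisets
rowMultisets {k} A = List.tabulate λ i →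
  concat (List.tabulate λ j → replicate (A ⟨ i , j ⟩) (suc (toℕ j)))

FishburnTree : Set
FishburnTree = Σ LTree IsFishburnTree

FishburnMatrix : Set
FishburnMatrix = Σ (∃ Matrix) (IsFishburnMatrix ∘ proj₂)

treeSize : FishburnTree → ℕ
treeSize (T , _) = #nodes T

matrixSize : FishburnMatrix → ℕ
matrixSize ((_ , A) , _) = entrySum A

-- Equality in these setoids ignores the proofs of the defining properties.
𝒯 : Setoid 0ℓ 0ℓ
𝒯 = On.setoid {B = FishburnTree} (≡.setoid LTree) proj₁

ℳ : Setoid 0ℓ 0ℓ
ℳ = On.setoid {B = FishburnMatrix} (≡.setoid (∃ Matrix)) proj₁

𝒯[_] : ℕ → Setoid 0ℓ 0ℓ
𝒯[ n ] = On.setoid {B = Σ[ T ∈ FishburnTree ] treeSize T ≡ n} 𝒯 proj₁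

ℳ[_] : ℕ → Setoid 0ℓ 0ℓ
ℳ[ n ] = On.setoid {B = Σ[ A ∈ FishburnMatrix ] matrixSize A ≡ n} ℳ proj₁

-- β̄ sends a Fishburn matrix A to the unique Fishburn tree T such that Isβ̄ A T.
Isβ̄ : FishburnMatrix → FishburnTree → Set
Isβ̄ ((_ , A) , _) (T , _) = 𝔓 T ≋ rowMultisets A

infix 4 ∣_∣≡_
∣_∣≡_ : Setoid 0ℓ 0ℓ → ℕ → Set
∣ S ∣≡ c = Inverse S (≡.setoid (Fin c))

-- The remaining lemmas show that rpath v is the unique maximal right path containing
-- v, and that diag T is the unique maximal left path containing the root of T.

module _ {V : Set} {child : V → Maybe V}
         (child-injective : ∀ {u v w} → child u ≡ just w → child v ≡ just w → u ≡ v) where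

  private
    _↦_ : V → V → Set
    u ↦ w = child u ≡ just w

    data _↦*_ (u : V) : V → Set where
      ε   : u ↦* u
      _▻_ : ∀ {v w} → u ↦* v → v ↦ w → u ↦* w

    _◅_ : ∀ {u v w} → u ↦ v → v ↦* w → u ↦* w
    e ◅ ε       = ε ▻ e
    e ◅ (s ▻ f) = (e ◅ s) ▻ f

    reach : ∀ {x xs v} → Linked _↦_ (x ∷ xs) → v ∈ x ∷ xs → x ↦* v
    reach _        (here refl) = ε
    reach (e ∷ es) (there v∈)  = e ◅ reach es v∈

    origin-unique : ∀ {x y v} → (∀ u → child u ≢ just x) → (∀ u → child u ≢ just y) →
                    x ↦* v → y ↦* v → x ≡ y
    origin-unique _  _  ε       ε       = refl
    origin-unique ¬x _  ε       (_ ▻ e) = contradiction e (¬x _)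
    origin-unique _  ¬y (_ ▻ e) ε       = contradiction e (¬y _)
    origin-unique ¬x ¬y (s ▻ e) (t ▻ f) with refl ← child-injective e f =
      origin-unique ¬x ¬y s t

    tail-unique : ∀ {x xs ys a b} →
      Linked _↦_ (x ∷ xs) → last (x ∷ xs) ≡ just a → child a ≡ nothing →
      Linked _↦_ (x ∷ ys) → last (x ∷ ys) ≡ just b → child b ≡ nothing → xs ≡ ys
    tail-unique [-] refl _ [-] _ _ = refl
    tail-unique [-] refl a↛ (e ∷ _) _ _ with () ← trans (sym a↛) e
    tail-unique (e ∷ _) _ _ [-] refl b↛ with () ← trans (sym b↛) e
    tail-unique (e ∷ es) la a↛ (f ∷ fs) lb b↛
      with refl ← just-injective (trans (sym e) f) =
      cong (_ ∷_) (tail-unique es la a↛ fs lb b↛)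

  maximalPath-unique : ∀ {v ws ws′} →
    IsMaximalPath child ws → v ∈ ws → IsMaximalPath child ws′ → v ∈ ws′ → ws ≡ ws′
  maximalPath-unique {ws = _ ∷ _} {ws′ = _ ∷ _}
    record { head≡ = refl ; last≡ = la ; linked = es ; w₁-not-child = ¬x ; wₘ-no-child = a↛ } v∈
    record { head≡ = refl ; last≡ = lb ; linked = fs ; w₁-not-child = ¬y ; wₘ-no-child = b↛ } v∈′
    with refl ← origin-unique ¬x ¬y (reach es v∈) (reach fs v∈′) =
    cong (_ ∷_) (tail-unique es la a↛ fs lb b↛)

private
  map≢ : ∀ {A B : Set} {f : A → B} {y} → (∀ x → f x ≢ y) → ∀ x? → Maybe.map f x? ≢ just y
  map≢ f≢y (just x) eq = f≢y x (just-injective eq)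

  left-injective : ∀ {l m r} {u v : Node l} → left {l} {m} {r} u ≡ left v → u ≡ v
  left-injective refl = refl

  right-injective : ∀ {l m r} {u v : Node r} → right {l} {m} {r} u ≡ right v → u ≡ v
  right-injective refl = refl

  unleft : ∀ {l m r x?} {y : Node l} →
           Maybe.map (left {l} {m} {r}) x? ≡ just (left y) → x? ≡ just y
  unleft = map-injective left-injective

  unright : ∀ {l m r x?} {y : Node r} →
            Maybe.map (right {l} {m} {r}) x? ≡ just (right y) → x? ≡ just y
  unright = map-injective right-injective

  lchild≢root : ∀ {l m r} (u : Node (node l m r)) → lchild u ≢ just root
  lchild≢root (root {l = l}) = map≢ (λ _ ()) (rootOf l)
  lchild≢root (left u)       = map≢ (λ _ ()) (lchild u)
  lchild≢root (right u)      = map≢ (λ _ ()) (lchild u)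

  rchild≢root : ∀ {l m r} (u : Node (node l m r)) → rchild u ≢ just root
  rchild≢root (root {r = r}) = map≢ (λ _ ()) (rootOf r)
  rchild≢root (left u)       = map≢ (λ _ ()) (rchild u)
  rchild≢root (right u)      = map≢ (λ _ ()) (rchild u)

  rootOf-root : ∀ {T} {v : Node T} → rootOf T ≡ just v →
                (∀ u → lchild u ≢ just v) × (∀ u → rchild u ≢ just v)
  rootOf-root {node _ _ _} refl = lchild≢root , rchild≢root

lchild-injective : ∀ {T} {u v w : Node T} → lchild u ≡ just w → lchild v ≡ just w → u ≡ v
lchild-injective {u = u} {w = root} p q = contradiction p (lchild≢root u)
lchild-injective {u = root} {root} p q = refl
lchild-injective {u = root} {left v} {left w} p q =
  contradiction (unleft q) (proj₁ (rootOf-root (unleft p)) v)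
lchild-injective {u = left u} {root} {left w} p q =
  contradiction (unleft p) (proj₁ (rootOf-root (unleft q)) u)
lchild-injective {u = left u} {left v} {left w} p q = cong left (lchild-injective (unleft p) (unleft q))
lchild-injective {u = right u} {w = left w} p q = contradiction p (map≢ (λ _ ()) (lchild u))
lchild-injective {v = right v} {w = left w} p q = contradiction q (map≢ (λ _ ()) (lchild v))
lchild-injective {u = right u} {right v} {right w} p q = cong right (lchild-injective (unright p) (unright q))
lchild-injective {u = root {l = l}} {w = right w} p q = contradiction p (map≢ (λ _ ()) (rootOf l))
lchild-injective {v = root {l = l}} {w = right w} p q = contradiction q (map≢ (λ _ ()) (rootOf l))
lchild-injective {u = left u} {w = right w} p q = contradiction p (map≢ (λ _ ()) (lchild u))
lchild-injective {v = left v} {w = right w} p q = contradiction q (map≢ (λ _ ()) (lchild v))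

rchild-injective : ∀ {T} {u v w : Node T} → rchild u ≡ just w → rchild v ≡ just w → u ≡ v
rchild-injective {u = u} {w = root} p q = contradiction p (rchild≢root u)
rchild-injective {u = root} {root} p q = refl
rchild-injective {u = root} {right v} {right w} p q =
  contradiction (unright q) (proj₂ (rootOf-root (unright p)) v)
rchild-injective {u = right u} {root} {right w} p q =
  contradiction (unright p) (proj₂ (rootOf-root (unright q)) u)
rchild-injective {u = right u} {right v} {right w} p q = cong right (rchild-injective (unright p) (unright q))
rchild-injective {u = left u} {w = right w} p q = contradiction p (map≢ (λ _ ()) (rchild u))
rchild-injective {v = left v} {w = right w} p q = contradiction q (map≢ (λ _ ()) (rchild v))
rchild-injective {u = left u} {left v} {left w} p q = cong left (rchild-injective (unleft p) (unleft q))
rchild-injective {u = root {r = r}} {w = left w} p q = contradiction p (map≢ (λ _ ()) (rootOf r))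
rchild-injective {v = root {r = r}} {w = left w} p q = contradiction q (map≢ (λ _ ()) (rootOf r))
rchild-injective {u = right u} {w = left w} p q = contradiction p (map≢ (λ _ ()) (rchild u))
rchild-injective {v = right v} {w = left w} p q = contradiction q (map≢ (λ _ ()) (rchild v))

private
  -- Embeddings f that commute with child preserve everything but the maximality of
  -- the path at its start.
  module Embedding {V V′ : Set} {child : V → Maybe V} {child′ : V′ → Maybe V′} (f : V → V′)
                   (commutes : ∀ v → child′ (f v) ≡ Maybe.map f (child v)) where

    linked⁺ : ∀ {ws} → Linked (λ w w′ → child w ≡ just w′) ws →
              Linked (λ w w′ → child′ w ≡ just w′) (map f ws)
    linked⁺ []       = []
    linked⁺ [-]      = [-]
    linked⁺ (e ∷ es) = trans (commutes _) (cong (Maybe.map f) e) ∷ linked⁺ es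

    path⁺ : ∀ {ws} (p : IsMaximalPath child ws) →
            (∀ u → child′ u ≢ just (f (IsMaximalPath.w₁ p))) →
            IsMaximalPath child′ (map f ws)
    path⁺ {ws} p ¬w₁ = record
      { w₁           = f w₁
      ; wₘ           = f wₘ
      ; head≡        = trans (head-map ws) (cong (Maybe.map f) head≡)
      ; last≡        = trans (last-map f ws) (cong (Maybe.map f) last≡)
      ; linked       = linked⁺ linked
      ; w₁-not-child = ¬w₁
      ; wₘ-no-child  = trans (commutes wₘ) (cong (Maybe.map f) wₘ-no-child)
      }
      where open IsMaximalPath p

    cons⁺ : ∀ {ws y} (p : IsMaximalPath child ws) →
            child′ y ≡ just (f (IsMaximalPath.w₁ p)) → (∀ u → child′ u ≢ just y) →
            IsMaximalPath child′ (y ∷ map f ws)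
    cons⁺ {_ ∷ ws} {y}
      record { wₘ = wₘ ; head≡ = refl ; last≡ = l ; linked = es ; wₘ-no-child = a↛ } e ¬y = record
      { w₁           = y
      ; wₘ           = f wₘ
      ; head≡        = refl
      ; last≡        = trans (last-map f (_ ∷ ws)) (cong (Maybe.map f) l)
      ; linked       = e ∷ linked⁺ es
      ; w₁-not-child = ¬y
      ; wₘ-no-child  = trans (commutes wₘ) (cong (Maybe.map f) a↛)
      }

  singleton⁺ : ∀ {V : Set} {child : V → Maybe V} {v} →
               (∀ u → child u ≢ just v) → child v ≡ nothing → IsMaximalPath child (v ∷ [])
  singleton⁺ ¬v v↛ = record
    { head≡ = refl ; last≡ = refl ; linked = [-] ; w₁-not-child = ¬v ; wₘ-no-child = v↛ }

  lspine-isMaximalPath : ∀ {l m r} → IsMaximalPath lchild (diag (node l m r))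
  lspine-isMaximalPath {empty}      = singleton⁺ lchild≢root refl
  lspine-isMaximalPath {node l m r}
    with p ← lspine-isMaximalPath {l} {m} {r}
    with refl ← IsMaximalPath.head≡ p =
    Embedding.cons⁺ left (λ _ → refl) p refl lchild≢root

  rspine-isMaximalPath : ∀ {l m r} → IsMaximalPath rchild (rspine (node l m r))
  rspine-isMaximalPath {r = empty}      = singleton⁺ rchild≢root refl
  rspine-isMaximalPath {r = node l m r}
    with p ← rspine-isMaximalPath {l} {m} {r}
    with refl ← IsMaximalPath.head≡ p =
    Embedding.cons⁺ right (λ _ → refl) p refl rchild≢root

diag-isMaximalPath : ∀ {l m r} → let T = node l m r in
  IsMaximalPath lchild (diag T) × root ∈ diag T
diag-isMaximalPath = lspine-isMaximalPath , here refl

rpath-isMaximalPath : ∀ {T} (v : Node T) → IsMaximalPath rchild (rpath v)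
rpath-isMaximalPath root     = rspine-isMaximalPath
rpath-isMaximalPath (left v) with p ← rpath-isMaximalPath v =
  Embedding.path⁺ left (λ _ → refl) p λ where
    (root {r = r}) → map≢ (λ _ ()) (rootOf r)
    (left u)       → IsMaximalPath.w₁-not-child p u ∘ unleft
    (right u)      → map≢ (λ _ ()) (rchild u)
rpath-isMaximalPath (right v) with rpath v | rpath-isMaximalPath v
... | root ∷ ws    | p@(record { head≡ = refl }) = Embedding.cons⁺ right (λ _ → refl) p refl rchild≢root
... | left w ∷ ws  | p@(record { head≡ = refl }) = Embedding.path⁺ right (λ _ → refl) p λ where
  root      ()
  (left u)  → map≢ (λ _ ()) (rchild u)
  (right u) → IsMaximalPath.w₁-not-child p u ∘ unright
... | right w ∷ ws | p@(record { head≡ = refl }) = Embedding.path⁺ right (λ _ → refl) p λ where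
  root      ()
  (left u)  → map≢ (λ _ ()) (rchild u)
  (right u) → IsMaximalPath.w₁-not-child p u ∘ unright

∈-rpath : ∀ {T} (v : Node T) → v ∈ rpath v
∈-rpath root     = here refl
∈-rpath (left v) = ∈-map⁺ left (∈-rpath v)
∈-rpath (right v) with rpath v | ∈-rpath v
... | root ∷ _    | v∈ = there (∈-map⁺ right v∈)
... | left _ ∷ _  | v∈ = ∈-map⁺ right v∈
... | right _ ∷ _ | v∈ = ∈-map⁺ right v∈

{-# OPTIONS --safe #-}

-- A Fishburn tree is read off from its in-order traversal: a node has a left child exactly
-- if its label was not visited before, except for v₁. Right paths are weakly decreasing,
-- so each Wᵢ is determined by the multiset Bᵢ. The label i lies on the diagonal exactly if
-- i ∈ Bᵢ; otherwise Wᵢ hangs to the left of the first visited node labelled i, and all its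
-- labels are smaller than i. Hence the tree can be rebuilt from B₁ … Bₖ: stack the sorted
-- Bᵢ with i ∈ Bᵢ along the diagonal, and while traversing, insert the sorted Bᵢ to the left
-- of the first node labelled i. Since the inserted labels drop, this terminates. All of
-- [k] is reached by downward induction: i lies in some Bⱼ with j ≥ i, and if j > i then
-- Bⱼ is attached to a node labelled j.
module Submission where

open import Defs
open import Data.Bool using (true; false)
open import Data.Empty using (⊥-elim)
open import Data.Fin as Fin using (Fin; zero; suc; toℕ)
import Data.Fin.Properties as Fin
open import Data.List as List
  using (List; []; _∷_; _++_; map; length; concat; concatMap; head; filter; lookup; tabulate;
    replicate; deduplicate; cartesianProductWith; upTo)
open import Data.List.Properties
  using (++-assoc; ++-identityʳ; ∷-injectiveʳ; length-++; length-map; length-replicate;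
    length-tabulate; map-++; map-∘; map-cong-local; map-tabulate; tabulate-cong; concatMap-++;
    head-map; filter-++; filter-accept; filter-all; filter-none; filter-some)
open import Data.List.Membership.Propositional using (_∈_; _∉_)
open import Data.List.Membership.Propositional.Properties
  using (∈-++⁺ˡ; ∈-++⁺ʳ; ∈-++⁻; ∈-concat⁺′; ∈-concat⁻′; ∈-map⁺; ∈-map⁻; ∈-tabulate⁺; ∈-tabulate⁻;
    ∈-∃++; ∈-lookup; ∈-filter⁺; ∈-filter⁻; ∈-deduplicate⁺; ∈-deduplicate⁻;
    ∈-cartesianProductWith⁺; ∈-upTo⁺)
open import Data.List.Membership.Propositional.Properties.WithK using (unique∧set⇒bag)
open import Data.List.Relation.Binary.BagAndSetEquality using (∼bag⇒↭)
open import Data.List.Relation.Binary.Equality.Propositional using (≋⇒≡)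
open import Data.List.Relation.Binary.Permutation.Propositional
  using (_↭_; ↭-refl; ↭-reflexive; ↭-sym; ↭-trans; prep; ↭⇒↭ₛ; module PermutationReasoning)
open import Data.List.Relation.Binary.Permutation.Propositional.Properties as ↭
  using (shift; ++⁺; ++-comm; ∈-resp-↭; ↭-length; filter-↭)
open import Data.List.Relation.Binary.Pointwise as Pointwise using (Pointwise-length)
open import Data.List.Relation.Unary.All as All using (All; []; _∷_)
import Data.List.Relation.Unary.All.Properties as All
open import Data.List.Relation.Unary.AllPairs using (AllPairs; []; _∷_)
import Data.List.Relation.Unary.AllPairs.Properties as AllPairs
open import Data.List.Relation.Unary.Any as Any using (here; there; toSum)
open import Data.List.Relation.Unary.Sorted.TotalOrder.Properties
  using (Sorted⇒AllPairs; AllPairs⇒Sorted; ↗↭↗⇒≋)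
open import Data.List.Relation.Unary.Any.Properties using (lookup-index)
open import Data.List.Relation.Unary.Unique.Propositional using (Unique)
open import Data.List.Relation.Unary.Unique.DecPropositional.Properties using (deduplicate-!)
import Data.List.Relation.Unary.Unique.Propositional.Properties as Unique
import Data.List.Sort as Sort
open import Data.Maybe as Maybe using (Maybe; just; nothing; maybe′)
open import Data.Nat using (ℕ; zero; suc; pred; _≤_; _<_; _≥_; _+_; _⊔_; z≤n; s≤s; s≤s⁻¹; >-nonZero)
open import Data.Nat.ListAction using (sum)
open import Data.Nat.ListAction.Properties using (sum-↭)
open import Data.Nat.Properties as ℕ using (≤-trans; ≤-refl; n≤1+n; <-irrefl; ≤∧≢⇒<; m≤n⇒m<n∨m≡n)
open import Data.List.Membership.DecPropositional ℕ._≟_ using (_∈?_)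
open import Data.List.Membership.DecPropositional using () renaming (_∈?_ to ∈?-with)
open import Data.Product using (Σ-syntax; ∃; ∃-syntax; _×_; _,_; proj₁; proj₂)
import Data.Product.Properties as Product
open import Data.Sum using (_⊎_; inj₁; inj₂; [_,_]; map₁) renaming (map to ⊎-map)
open import Data.Tree.Binary using (leaf; node; #nodes)
open import Data.Unit using (tt)
open import Data.Vec as Vec using (Vec; []; _∷_)
import Data.Vec.Properties as Vec
open import Function using (_∘_; mk⇔; Inverse)
import Function.Construct.Composition as Composition
open import Relation.Binary using (Setoid; DecTotalOrder; DecidableEquality)
import Relation.Binary.Construct.On as On
import Relation.Binary.Construct.Flip.EqAndOrd as Flip
open import Relation.Binary.PropositionalEquality as ≡
  using (_≡_; _≢_; refl; sym; trans; cong; cong₂; subst; module ≡-Reasoning)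
open import Relation.Nullary using (¬_; Dec; yes; no; does; contradiction)
open import Relation.Nullary.Decidable using (dec-true; dec-false; map′; _×-dec_; _→-dec_; ¬?)
open import Relation.Unary using (Decidable)

-- Labels and right paths

-- The condition on `nub` is global: it compares a node with everything visited before it. Carrying
-- the list S of visited labels down the tree makes it local. `OffDiag` and `OnDiag` then describe
-- Fishburn trees by structural recursion, and the combinatorics takes place on these predicates and
-- on the lists `blocks` of labelled right paths. The definitions through nodes are linked to them
-- separately: by `blocks-inorder` for the paths, by `fishburn⇒on` and `on⇒fishburn` for the trees.
-- Two predicates are needed because a diagonal node owns the right path through itself, while any
-- other asctop owns the one through its left child. Multisets are compared by sorting: a weakly
-- decreasing list is a canonical representative, so equality up to permutation becomes equality,
-- and uniqueness of the tree becomes the equation `T ≡ assemble k`.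

data NonEmpty : LTree → Set where
  nonEmpty : ∀ {l m r} → NonEmpty (node l m r)

labels : LTree → List ℕ
labels empty        = []
labels (node l m r) = labels l ++ m ∷ labels r

spine : LTree → List ℕ
spine empty        = []
spine (node _ m r) = m ∷ spine r

Blocks : Set
Blocks = List (ℕ × List ℕ)

attach : ℕ → LTree → Blocks
attach m empty            = []
attach m l@(node _ _ _) = (m , spine l) ∷ []

-- Off the diagonal, the right path through the root of a subtree belongs to an asctop outside that
-- subtree, so `spine T` itself is not listed.
offBlocks : LTree → Blocks
offBlocks empty        = []
offBlocks (node l m r) = offBlocks l ++ attach m l ++ offBlocks r

-- The pairs (i , labels of Wᵢ), in the in-order of the asctops.
blocks : LTree → Blocks
blocks empty          = []
blocks (node l m r) = blocks l ++ (m , m ∷ spine r) ∷ offBlocks r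

diagLabels : LTree → List ℕ
diagLabels empty        = []
diagLabels (node l m r) = m ∷ diagLabels l

flatten : Blocks → List ℕ
flatten = concatMap proj₂

-- S holds the labels visited before the in-order traversal enters the tree, b bounds its
-- labels.
data OffDiag (S : List ℕ) (b : ℕ) : LTree → Set where
  leaf : ∀ {t} → OffDiag S b (leaf t)
  -- With root label `suc m`, the bound m on the left subtree encodes strict decrease. The
  -- alternative is the local form of `nub ≐ asctops` at a node that is not v₁.
  node : ∀ {l m r} → suc m ≤ b →
         suc m ∈ S × l ≡ leaf tt ⊎ suc m ∉ S × NonEmpty l →
         OffDiag S m l → OffDiag (suc m ∷ labels l ++ S) (suc m) r → OffDiag S b (node l (suc m) r)

-- Before a diagonal node only its left subtree is visited, whose labels are smaller, so the node is
-- the first with its label. It is also an asctop, through its left child or as v₁. Hence there is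
-- neither an S nor an alternative here.
data OnDiag (b : ℕ) : LTree → Set where
  leaf : ∀ {t} → OnDiag b (leaf t)
  node : ∀ {l m r} → suc m ≤ b → OnDiag m l →
         OffDiag (suc m ∷ labels l ++ []) (suc m) r → OnDiag b (node l (suc m) r)

private variable
  S     : List ℕ
  b x y : ℕ
  p     : List ℕ
  T     : LTree

off-label-bounds : OffDiag S b T → All [1⋯ b ] (labels T)
off-label-bounds leaf = []
off-label-bounds (node m≤b _ l r) =
  All.++⁺ (All.map (λ (1≤x , x≤m) → 1≤x , ≤-trans x≤m (≤-trans (n≤1+n _) m≤b)) (off-label-bounds l))
          ((s≤s z≤n , m≤b) ∷ All.map (λ (1≤x , x≤m) → 1≤x , ≤-trans x≤m m≤b) (off-label-bounds r))

on-label-bounds : OnDiag b T → All [1⋯ b ] (labels T)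
on-label-bounds leaf = []
on-label-bounds (node m≤b l r) =
  All.++⁺ (All.map (λ (1≤x , x≤m) → 1≤x , ≤-trans x≤m (≤-trans (n≤1+n _) m≤b)) (on-label-bounds l))
          ((s≤s z≤n , m≤b) ∷ All.map (λ (1≤x , x≤m) → 1≤x , ≤-trans x≤m m≤b) (off-label-bounds r))

All-spine : ∀ {P : ℕ → Set} T → All P (labels T) → All P (spine T)
All-spine empty        _ = []
All-spine (node l m r) a with pm ∷ pr ← All.++⁻ʳ (labels l) a = pm ∷ All-spine r pr

off-spine-bounds : OffDiag S b T → All [1⋯ b ] (spine T)
off-spine-bounds {T = T} o = All-spine T (off-label-bounds o)

off-spine-sorted : OffDiag S b T → AllPairs _≥_ (spine T)
off-spine-sorted leaf           = []
off-spine-sorted (node _ _ _ r) = All.map proj₂ (off-spine-bounds r) ∷ off-spine-sorted r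

∈-attach⁻ : ∀ {m e} l → e ∈ attach m l → e ≡ (m , spine l) × NonEmpty l
∈-attach⁻ (node _ _ _) (here refl) = refl , nonEmpty

∈-attach⁺ : ∀ {m l} → NonEmpty l → (m , spine l) ∈ attach m l
∈-attach⁺ nonEmpty = here refl

∈-offBlocks⁻ : ∀ {e} l m r → e ∈ offBlocks (node l m r) →
               e ∈ offBlocks l ⊎ (e ≡ (m , spine l) × NonEmpty l) ⊎ e ∈ offBlocks r
∈-offBlocks⁻ l m r e∈ with ∈-++⁻ (offBlocks l) e∈
... | inj₁ e∈l = inj₁ e∈l
... | inj₂ e∈′ with ∈-++⁻ (attach m l) e∈′
...   | inj₁ e∈m = inj₂ (inj₁ (∈-attach⁻ l e∈m))
...   | inj₂ e∈r = inj₂ (inj₂ e∈r)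

∈-blocks⁻ : ∀ {e} l m r → e ∈ blocks (node l m r) →
            e ∈ blocks l ⊎ e ≡ (m , m ∷ spine r) ⊎ e ∈ offBlocks r
∈-blocks⁻ l m r e∈ with ∈-++⁻ (blocks l) e∈
... | inj₁ e∈l          = inj₁ e∈l
... | inj₂ (here refl)  = inj₂ (inj₁ refl)
... | inj₂ (there e∈r)  = inj₂ (inj₂ e∈r)

offBlocks-key : ∀ T → (x , p) ∈ offBlocks T → x ∈ labels T
offBlocks-key (node l m r) e∈ with ∈-offBlocks⁻ l m r e∈
... | inj₁ e∈l               = ∈-++⁺ˡ (offBlocks-key l e∈l)
... | inj₂ (inj₁ (refl , _)) = ∈-++⁺ʳ (labels l) (here refl)
... | inj₂ (inj₂ e∈r)        = ∈-++⁺ʳ (labels l) (there (offBlocks-key r e∈r))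

blocks-key : ∀ T → (x , p) ∈ blocks T → x ∈ labels T
blocks-key (node l m r) e∈ with ∈-blocks⁻ l m r e∈
... | inj₁ e∈l         = ∈-++⁺ˡ (blocks-key l e∈l)
... | inj₂ (inj₁ refl) = ∈-++⁺ʳ (labels l) (here refl)
... | inj₂ (inj₂ e∈r)  = ∈-++⁺ʳ (labels l) (there (offBlocks-key r e∈r))

-- A block hangs from a node with a left child, whose label is therefore new there; S only grows on
-- the way down to that node.
off-fresh : OffDiag S b T → (x , p) ∈ offBlocks T → x ∉ S
off-fresh (node {l} {m} {r} _ new l-off r-off) e∈ x∈S with ∈-offBlocks⁻ l (suc m) r e∈
... | inj₁ e∈l        = off-fresh l-off e∈l x∈S
... | inj₂ (inj₂ e∈r) = off-fresh r-off e∈r (there (∈-++⁺ʳ (labels l) x∈S))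
off-fresh (node _ (inj₁ (_ , refl)) _ _) e∈ x∈S | inj₂ (inj₁ (refl , ()))
off-fresh (node _ (inj₂ (m∉S , _)) _ _)  e∈ x∈S | inj₂ (inj₁ (refl , _))  = m∉S x∈S

DistinctKeys : Blocks → Set
DistinctKeys = AllPairs (λ d e → proj₁ d ≢ proj₁ e)

cross : ∀ {ds es : Blocks} → (∀ {x p q} → (x , p) ∈ ds → (x , q) ∉ es) →
        All (λ d → All (λ e → proj₁ d ≢ proj₁ e) es) ds
cross disj = All.tabulate λ d∈ → All.tabulate λ { e∈ refl → disj d∈ e∈ }

-- Keys from the left subtree are at most m, hence differ from the root label; keys from the right
-- subtree avoid both because they are fresh for the enlarged S.
off-distinct : OffDiag S b T → DistinctKeys (offBlocks T)
off-distinct leaf = []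
off-distinct (node {l} {m} {r} _ _ l-off r-off) =
  AllPairs.++⁺ (off-distinct l-off)
    (AllPairs.++⁺ (single l) (off-distinct r-off) (cross λ d∈ e∈ →
      off-fresh r-off e∈ (here (cong proj₁ (proj₁ (∈-attach⁻ l d∈))))))
    (cross λ {x} d∈ e∈ → let x∈l = offBlocks-key l d∈ in case-right x∈l (∈-++⁻ (attach (suc m) l) e∈))
  where
  single : ∀ l → DistinctKeys (attach (suc m) l)
  single empty        = []
  single (node _ _ _) = [] ∷ []
  case-right : ∀ {x q} → x ∈ labels l → ¬ ((x , q) ∈ attach (suc m) l ⊎ (x , q) ∈ offBlocks r)
  case-right x∈l (inj₁ e∈) with refl , _ ← ∈-attach⁻ l e∈ =
    <-irrefl refl (proj₂ (All.lookup (off-label-bounds l-off) x∈l))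
  case-right x∈l (inj₂ e∈) = off-fresh r-off e∈ (there (∈-++⁺ˡ x∈l))

on-distinct : OnDiag b T → DistinctKeys (blocks T)
on-distinct leaf = []
on-distinct (node {l} {m} {r} _ l-on r-off) =
  AllPairs.++⁺ (on-distinct l-on)
    (All.tabulate (λ { e∈ refl → off-fresh r-off e∈ (here refl) }) ∷ off-distinct r-off)
    (cross λ where
      d∈ (here refl) → <-irrefl refl (proj₂ (All.lookup (on-label-bounds l-on) (blocks-key l d∈)))
      d∈ (there e∈)  → off-fresh r-off e∈ (there (∈-++⁺ˡ (blocks-key l d∈))))

-- The first node with a label outside S has a left child. If the recursion on the right subtree
-- finds x in its enlarged S, then x is the root label, a label of the left subtree, or in S.
off-label-block : OffDiag S b T → x ∈ labels T → x ∈ S ⊎ ∃[ p ] (x , p) ∈ offBlocks T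
off-label-block {S = S} {x = x} (node {l} {m} {r} _ new l-off r-off) x∈ = go (∈-++⁻ (labels l) x∈)
  where
  Goal = x ∈ S ⊎ ∃[ p ] (x , p) ∈ offBlocks (node l (suc m) r)
  in-left : x ∈ labels l → Goal
  in-left x∈l with off-label-block l-off x∈l
  ... | inj₁ x∈S      = inj₁ x∈S
  ... | inj₂ (p , e∈) = inj₂ (p , ∈-++⁺ˡ e∈)
  at-root : x ≡ suc m → Goal
  at-root refl = ⊎-map proj₁ (λ (_ , ne) → _ , ∈-++⁺ʳ (offBlocks l) (∈-++⁺ˡ (∈-attach⁺ ne))) new
  go : x ∈ labels l ⊎ x ∈ suc m ∷ labels r → Goal
  go (inj₁ x∈l)        = in-left x∈l
  go (inj₂ (here x≡m)) = at-root x≡m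
  go (inj₂ (there x∈r)) with off-label-block r-off x∈r
  ... | inj₂ (p , e∈)    = inj₂ (p , ∈-++⁺ʳ (offBlocks l) (∈-++⁺ʳ (attach (suc m) l) e∈))
  ... | inj₁ (here x≡m)  = at-root x≡m
  ... | inj₁ (there x∈′) with ∈-++⁻ (labels l) x∈′
  ...   | inj₁ x∈l = in-left x∈l
  ...   | inj₂ x∈S = inj₁ x∈S

on-label-block : OnDiag b T → x ∈ labels T → ∃[ p ] (x , p) ∈ blocks T
on-label-block {x = x} (node {l} {m} {r} _ l-on r-off) x∈ = go (∈-++⁻ (labels l) x∈)
  where
  Goal = ∃[ p ] (x , p) ∈ blocks (node l (suc m) r)
  in-left : x ∈ labels l → Goal
  in-left x∈l with p , e∈ ← on-label-block l-on x∈l = p , ∈-++⁺ˡ e∈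
  go : x ∈ labels l ⊎ x ∈ suc m ∷ labels r → Goal
  go (inj₁ x∈l)         = in-left x∈l
  go (inj₂ (here refl)) = _ , ∈-++⁺ʳ (blocks l) (here refl)
  go (inj₂ (there x∈r)) with off-label-block r-off x∈r
  ... | inj₂ (p , e∈)    = p , ∈-++⁺ʳ (blocks l) (there e∈)
  ... | inj₁ (here refl) = _ , ∈-++⁺ʳ (blocks l) (here refl)
  ... | inj₁ (there x∈′) with ∈-++⁻ (labels l) x∈′
  ...   | inj₁ x∈l = in-left x∈l

flatten-attach : ∀ m l → flatten (attach m l) ≡ spine l
flatten-attach m empty          = refl
flatten-attach m l@(node _ _ _) = ++-identityʳ (spine l)

-- Every node lies on exactly one right path; `spine T` supplies the one that `offBlocks` leaves to
-- an outer asctop.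
flatten-offBlocks : ∀ T → flatten (offBlocks T) ++ spine T ↭ labels T
flatten-offBlocks empty        = ↭-refl
flatten-offBlocks (node l m r) = begin
  flatten (offBlocks l ++ attach m l ++ offBlocks r) ++ m ∷ spine r
    ≡⟨ cong (_++ m ∷ spine r) (trans (concatMap-++ proj₂ (offBlocks l) _)
         (cong (fl ++_) (trans (concatMap-++ proj₂ (attach m l) _) (cong (_++ fr) (flatten-attach m l))))) ⟩
  (fl ++ spine l ++ fr) ++ m ∷ spine r
    ≡⟨ cong (_++ m ∷ spine r) (++-assoc fl (spine l) fr) ⟨
  ((fl ++ spine l) ++ fr) ++ m ∷ spine r
    ≡⟨ ++-assoc (fl ++ spine l) fr _ ⟩
  (fl ++ spine l) ++ fr ++ m ∷ spine r
    ↭⟨ ++⁺ (flatten-offBlocks l) (↭-trans (shift m fr (spine r)) (prep m (flatten-offBlocks r))) ⟩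
  labels l ++ m ∷ labels r ∎
  where
  open PermutationReasoning
  fl = flatten (offBlocks l)
  fr = flatten (offBlocks r)

-- This is the source of size preservation and of the nonzero columns of `β T`.
flatten-blocks : ∀ T → flatten (blocks T) ↭ labels T
flatten-blocks empty        = ↭-refl
flatten-blocks (node l m r) = begin
  flatten (blocks l ++ (m , m ∷ spine r) ∷ offBlocks r)
    ≡⟨ concatMap-++ proj₂ (blocks l) _ ⟩
  flatten (blocks l) ++ m ∷ spine r ++ flatten (offBlocks r)
    ↭⟨ ++⁺ (flatten-blocks l) (prep m (↭-trans (++-comm (spine r) _) (flatten-offBlocks r))) ⟩
  labels l ++ m ∷ labels r ∎
  where open PermutationReasoning

length-offBlocks : ∀ T → length (offBlocks T) ≤ #nodes T
length-offBlocks empty        = z≤n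
length-offBlocks (node l m r) = begin
  length (offBlocks l ++ attach m l ++ offBlocks r)
    ≡⟨ trans (length-++ (offBlocks l)) (cong (length (offBlocks l) +_) (length-++ (attach m l))) ⟩
  length (offBlocks l) + (length (attach m l) + length (offBlocks r))
    ≤⟨ ℕ.+-mono-≤ (length-offBlocks l) (ℕ.+-mono-≤ (length-attach l) (length-offBlocks r)) ⟩
  #nodes l + suc (#nodes r) ∎
  where
  open ℕ.≤-Reasoning
  length-attach : ∀ l → length (attach m l) ≤ 1
  length-attach empty        = z≤n
  length-attach (node _ _ _) = s≤s z≤n

length-blocks : ∀ T → length (blocks T) ≤ #nodes T
length-blocks empty        = z≤n
length-blocks (node l m r) = begin
  length (blocks l ++ (m , m ∷ spine r) ∷ offBlocks r)
    ≡⟨ length-++ (blocks l) ⟩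
  length (blocks l) + suc (length (offBlocks r))
    ≤⟨ ℕ.+-mono-≤ (length-blocks l) (s≤s (length-offBlocks r)) ⟩
  #nodes l + suc (#nodes r) ∎
  where open ℕ.≤-Reasoning

spine-nonEmpty : NonEmpty T → spine T ≢ []
spine-nonEmpty nonEmpty ()

off-block : OffDiag S b T → (x , p) ∈ offBlocks T → p ≢ [] × All (_< x) p × AllPairs _≥_ p
off-block (node {l} {m} {r} _ _ l-off r-off) e∈ with ∈-offBlocks⁻ l (suc m) r e∈
... | inj₁ e∈l                = off-block l-off e∈l
... | inj₂ (inj₁ (refl , ne)) =
  spine-nonEmpty ne , All.map (s≤s ∘ proj₂) (off-spine-bounds l-off) , off-spine-sorted l-off
... | inj₂ (inj₂ e∈r)         = off-block r-off e∈r

-- The path of a diagonal node starts with its own label, whereas any other path hangs to the left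
-- of its key. This dichotomy lets the diagonal be read off from the lists alone.
on-block : OnDiag b T → (x , p) ∈ blocks T →
           p ≢ [] × (x ∈ diagLabels T ⊎ All (_< x) p) × All (_≤ x) p × AllPairs _≥_ p
on-block (node {l} {m} {r} _ l-on r-off) e∈ with ∈-blocks⁻ l (suc m) r e∈
... | inj₁ e∈l with p≢[] , diag⊎< , rest ← on-block l-on e∈l =
  p≢[] , map₁ there diag⊎< , rest
... | inj₂ (inj₁ refl) = (λ ()) , inj₁ (here refl) , ≤-refl ∷ spine≤ , spine≤ ∷ off-spine-sorted r-off
  where spine≤ = All.map proj₂ (off-spine-bounds r-off)
... | inj₂ (inj₂ e∈r) with p≢[] , p<x , sorted ← off-block r-off e∈r =
  p≢[] , inj₂ p<x , All.map ℕ.<⇒≤ p<x , sorted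

diagLabels≤ : OnDiag b T → x ∈ diagLabels T → x ≤ b
diagLabels≤ (node m≤b _ _)    (here refl) = m≤b
diagLabels≤ (node m≤b l-on _) (there x∈)  =
  ≤-trans (diagLabels≤ l-on x∈) (≤-trans (n≤1+n _) m≤b)

-- Rebuilding a tree from its right paths

module Construction (B : ℕ → List ℕ) where

  mutual
    -- `build` lays out one right path and `grow` supplies the left subtrees. As the list `B x` is
    -- arbitrary, the recursion is not structural; the fuel f is spent only on steps to the left,
    -- where labels drop, so any bound on the labels is enough fuel.
    build : ℕ → List ℕ → List ℕ → LTree
    build f S []       = leaf tt
    build f S (x ∷ xs) = node (grow f S x) x (build f (x ∷ labels (grow f S x) ++ S) xs)

    grow : ℕ → List ℕ → ℕ → LTree
    grow zero    S x = leaf tt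
    grow (suc f) S x with x ∈? S
    ... | yes _ = leaf tt
    ... | no  _ = build f S (B x)

  -- For a weakly decreasing list bounded by i this amounts to `i ∈ B i`; xs is the right path
  -- beyond the diagonal node.
  IsDiag : ℕ → Set
  IsDiag i = ∃[ xs ] B i ≡ i ∷ xs

  isDiag? : ∀ i → Dec (IsDiag i)
  isDiag? i with B i
  ... | []     = no λ ()
  ... | x ∷ xs with x ℕ.≟ i
  ...   | yes refl = yes (xs , refl)
  ...   | no  x≢i  = no λ { (_ , refl) → x≢i refl }

  -- Diagonal labels increase towards the root, so going through the labels upwards puts each new
  -- diagonal node on top.
  assemble : ℕ → LTree
  assemble zero    = leaf tt
  assemble (suc i) with isDiag? (suc i)
  ... | yes (xs , _) = node l (suc i) (build (suc i) (suc i ∷ labels l ++ []) xs)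
    where l = assemble i
  ... | no  _        = assemble i

  Matches : Blocks → Set
  Matches = All (λ (x , p) → p ≡ B x)

  spine-build : ∀ f S xs → spine (build f S xs) ≡ xs
  spine-build f S []       = refl
  spine-build f S (x ∷ xs) = cong (x ∷_) (spine-build f _ xs)

  matches-attach : ∀ {m} l → spine l ≡ B m → Matches (attach m l)
  matches-attach empty        _  = []
  matches-attach (node _ _ _) eq = eq ∷ []

  mutual
    -- A left subtree is either a leaf, which contributes no block, or built from `B x` for the
    -- label x above it.
    matches-build : ∀ f S xs → Matches (offBlocks (build f S xs))
    matches-build f S []       = []
    matches-build f S (x ∷ xs) =
      All.++⁺ (proj₁ gr) (All.++⁺ (proj₂ gr) (matches-build f _ xs))
      where gr = matches-grow f S x

    matches-grow : ∀ f S x → Matches (offBlocks (grow f S x)) × Matches (attach x (grow f S x))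
    matches-grow zero    S x = [] , []
    matches-grow (suc f) S x with x ∈? S
    ... | yes _ = [] , []
    ... | no  _ = matches-build f S (B x) , matches-attach (build f S (B x)) (spine-build f S (B x))

  matches-assemble : ∀ i → Matches (blocks (assemble i))
  matches-assemble zero    = []
  matches-assemble (suc i) with isDiag? (suc i)
  ... | yes (xs , eq) = All.++⁺ (matches-assemble i)
    (trans (cong (suc i ∷_) (spine-build (suc i) _ xs)) (sym eq) ∷ matches-build (suc i) _ xs)
  ... | no  _         = matches-assemble i

  -- The alternative in `OffDiag` agrees with the decision taken by `grow`, and a nonempty left
  -- subtree begins a block, which `Matches` identifies with the list that `grow` would use.
  rebuild-off : ∀ f → OffDiag S b T → b ≤ f → Matches (offBlocks T) → T ≡ build f S (spine T)
  rebuild-off f leaf _ _ = refl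
  rebuild-off zero (node m≤b _ _ _) b≤0 _ with () ← ≤-trans m≤b b≤0
  rebuild-off {S} (suc f) (node {l} {m} {r} m≤b new l-off r-off) b≤f ok =
    -- The right subtree is replaced first, since the list of visited labels it is built with
    -- mentions `l`.
    trans (cong (node l (suc m)) (rebuild-off (suc f) r-off m≤f (All.++⁻ʳ (attach (suc m) l) ok′)))
          (cong (λ t → node t (suc m) (build (suc f) (suc m ∷ labels t ++ S) (spine r))) (grown new))
    where
    m≤f = ≤-trans m≤b b≤f
    ok′ = All.++⁻ʳ (offBlocks l) ok
    grown : suc m ∈ S × l ≡ leaf tt ⊎ suc m ∉ S × NonEmpty l → l ≡ grow (suc f) S (suc m)
    grown new with suc m ∈? S | new
    ... | yes _   | inj₁ (_ , l≡leaf) = l≡leaf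
    ... | no  m∉S | inj₁ (m∈S , _)    = contradiction m∈S m∉S
    ... | yes m∈S | inj₂ (m∉S , _)    = contradiction m∈S m∉S
    ... | no  _   | inj₂ (_ , ne)     =
      trans (rebuild-off f l-off (s≤s⁻¹ m≤f) (All.++⁻ˡ (offBlocks l) ok))
            (cong (build f S) (All.lookup (All.++⁻ˡ (attach (suc m) l) ok′) (∈-attach⁺ ne)))

  -- The hypothesis on diagonal labels prevents `assemble` from adding a node that T lacks.
  -- Conversely, a root labelled `suc i` has a block starting with its own label, which forces
  -- `IsDiag`.
  rebuild-on : ∀ i → OnDiag i T → Matches (blocks T) →
               (∀ {x} → [1⋯ i ] x → IsDiag x → x ∈ diagLabels T) → T ≡ assemble i
  rebuild-on zero    leaf _ _ = refl
  rebuild-on (suc i) leaf _ diag with isDiag? (suc i)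
  ... | yes d with () ← diag (s≤s z≤n , ≤-refl) d
  ... | no  _ = rebuild-on i leaf [] λ (1≤x , x≤i) → diag (1≤x , ≤-trans x≤i (n≤1+n i))
  rebuild-on (suc i) (node {l} {m} {r} m≤i l-on r-off) ok diag with m≤n⇒m<n∨m≡n (s≤s⁻¹ m≤i)
  ... | inj₁ m<i with isDiag? (suc i)
  ...   | no  _ = rebuild-on i (node m<i l-on r-off) ok λ (1≤x , x≤i) → diag (1≤x , ≤-trans x≤i (n≤1+n i))
  ...   | yes d = contradiction (diag (s≤s z≤n , ≤-refl) d) λ where
    (here refl) → <-irrefl refl m<i
    (there i∈)  → <-irrefl refl (≤-trans (≤-trans m<i (n≤1+n i)) (diagLabels≤ l-on i∈))
  rebuild-on (suc i) (node {l} {m} {r} m≤i l-on r-off) ok diag | inj₂ refl with isDiag? (suc i)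
  ... | no  ¬d = contradiction (spine r , sym (All.head (All.++⁻ʳ (blocks l) ok))) ¬d
  ... | yes (xs , eq) = cong₂ (λ t → node t (suc i)) l≡
    (trans r≡ (cong₂ (λ t → build (suc i) (suc i ∷ labels t ++ [])) l≡ r≡xs))
    where
    ok′ = All.++⁻ʳ (blocks l) ok
    l≡ : l ≡ assemble i
    l≡ = rebuild-on i l-on (All.++⁻ˡ (blocks l) ok) λ (1≤x , x≤i) d →
      [ (λ { refl → ⊥-elim (<-irrefl refl x≤i) }) , (λ z → z) ]
        (toSum (diag (1≤x , ≤-trans x≤i (n≤1+n i)) d))
    r≡ = rebuild-off (suc i) r-off ≤-refl (All.tail ok′)
    r≡xs : spine r ≡ xs
    r≡xs = ∷-injectiveʳ (trans (All.head ok′) eq)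

  record IsFamily (k : ℕ) : Set where
    field
      nonempty : ∀ {x} → [1⋯ k ] x → B x ≢ []
      bounded  : ∀ {x} → [1⋯ k ] x → All [1⋯ x ] (B x)
      sorted   : ∀ {x} → [1⋯ k ] x → AllPairs _≥_ (B x)
      covers   : ∀ {y} → [1⋯ k ] y → ∃[ x ] [1⋯ k ] x × y ∈ B x

  module _ {k : ℕ} (B-family : IsFamily k) where
    open IsFamily B-family

    -- The head of the list is at most x by the bound and at least x by the order.
    self∈⇒isDiag : [1⋯ k ] x → x ∈ B x → IsDiag x
    self∈⇒isDiag {x} x∈k x∈B with B x | bounded x∈k | sorted x∈k
    self∈⇒isDiag x∈k (here refl) | _ ∷ xs | _             | _       = xs , refl
    self∈⇒isDiag x∈k (there x∈)  | _ ∷ xs | (_ , y≤x) ∷ _ | y≥ ∷ _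
      with refl ← ℕ.≤-antisym y≤x (All.lookup y≥ x∈) = xs , refl

    mutual
      -- The condition on S says that all diagonal labels up to b have been visited. It makes the
      -- list inserted at an unvisited label stay strictly below that label.
      off-build : ∀ f xs → b ≤ f → b ≤ k → All [1⋯ b ] xs → AllPairs _≥_ xs →
                  (∀ {x} → [1⋯ b ] x → x ∉ S → x ∉ B x) → OffDiag S b (build f S xs)
      off-build f [] _ _ _ _ _ = leaf
      off-build (suc f) (suc m ∷ xs) b≤f b≤k ((_ , m≤b) ∷ bounds) (m≥ ∷ sorted-xs) fresh =
        node m≤b (new-grow f _ m≤k)
          (off-grow f (s≤s⁻¹ m≤f) m≤k λ (1≤x , x≤m) → fresh (1≤x , ≤-trans x≤m m≤b))
          (off-build (suc f) xs m≤f m≤k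
            (All.zipWith (λ ((1≤x , _) , x≤m) → 1≤x , x≤m) (bounds , m≥)) sorted-xs
            λ (1≤x , x≤m) x∉ → fresh (1≤x , ≤-trans x≤m m≤b) λ x∈S → x∉ (there (∈-++⁺ʳ _ x∈S)))
        where
        m≤k = ≤-trans m≤b b≤k
        m≤f = ≤-trans m≤b b≤f
      off-build zero (zero ∷ _)    _ _ ((() , _) ∷ _)
      off-build zero (suc _ ∷ _) b≤0 _ ((_ , m≤b) ∷ _) with () ← ≤-trans m≤b b≤0

      off-grow : ∀ {m} f → m ≤ f → suc m ≤ k → (∀ {x} → [1⋯ suc m ] x → x ∉ S → x ∉ B x) →
                 OffDiag S m (grow (suc f) S (suc m))
      off-grow {S} {m} f m≤f m≤k fresh with suc m ∈? S
      ... | yes _   = leaf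
      ... | no  m∉S = off-build f (B (suc m)) m≤f (ℕ.<⇒≤ m≤k)
        (All.tabulate λ y∈ → let (1≤y , y≤m) = All.lookup (bounded m∈k) y∈ in
          1≤y , s≤s⁻¹ (≤∧≢⇒< y≤m λ { refl → fresh (s≤s z≤n , ≤-refl) m∉S y∈ }))
        (sorted m∈k) λ (1≤x , x≤m) → fresh (1≤x , ≤-trans x≤m (n≤1+n m))
        where m∈k = s≤s z≤n , m≤k

      new-grow : ∀ {m} f S → suc m ≤ k →
                 suc m ∈ S × grow (suc f) S (suc m) ≡ leaf tt ⊎
                 suc m ∉ S × NonEmpty (grow (suc f) S (suc m))
      new-grow {m} f S m≤k with suc m ∈? S
      ... | yes m∈S = inj₁ (m∈S , refl)
      ... | no  m∉S with B (suc m) | nonempty {suc m} (s≤s z≤n , m≤k)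
      ...   | []    | ≢[] = contradiction refl ≢[]
      ...   | _ ∷ _ | _   = inj₂ (m∉S , nonEmpty)

    -- The second component is carried along because it provides the condition on S in `off-build`
    -- for the right subtree of the next diagonal node.
    on-assemble : ∀ i → i ≤ k →
                  OnDiag i (assemble i) × (∀ {x} → [1⋯ i ] x → x ∈ B x → x ∈ labels (assemble i))
    on-assemble zero    _   = leaf , λ { (s≤s _ , ()) }
    on-assemble (suc i) i≤k with isDiag? (suc i) | on-assemble i (ℕ.<⇒≤ i≤k)
    ... | no ¬d | i-on , diag = on-weaken i-on , λ { x∈i@(1≤x , x≤i) x∈ → case x∈i x∈ (m≤n⇒m<n∨m≡n x≤i) }
      where
      on-weaken : OnDiag i T → OnDiag (suc i) T
      on-weaken leaf = leaf
      on-weaken (node m≤i l r) = node (≤-trans m≤i (n≤1+n i)) l r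
      case : [1⋯ suc i ] x → x ∈ B x → x < suc i ⊎ x ≡ suc i → x ∈ labels (assemble i)
      case (1≤x , _) x∈ (inj₁ x<i) = diag (1≤x , s≤s⁻¹ x<i) x∈
      case (1≤x , x≤i) x∈ (inj₂ refl) = contradiction (self∈⇒isDiag (1≤x , i≤k) x∈) ¬d
    ... | yes (xs , eq) | i-on , diag with bounded {suc i} (s≤s z≤n , i≤k) | sorted {suc i} (s≤s z≤n , i≤k)
    ...   | bounds | sorted-xs rewrite eq with _ ∷ bounds-xs ← bounds | _ ∷ sorted-xs ← sorted-xs =
      node ≤-refl i-on (off-build (suc i) xs ≤-refl i≤k bounds-xs sorted-xs λ x∈i x∉ x∈ →
          x∉ (case x∈i x∈ here (λ x∈l → there (∈-++⁺ˡ x∈l)))) ,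
      λ x∈i x∈ → case x∈i x∈ (λ { refl → ∈-++⁺ʳ (labels (assemble i)) (here refl) }) ∈-++⁺ˡ
      where
      case : {A : Set} → [1⋯ suc i ] x → x ∈ B x → (x ≡ suc i → A) → (x ∈ labels (assemble i) → A) → A
      case (1≤x , x≤i) x∈ f g with m≤n⇒m<n∨m≡n x≤i
      ... | inj₁ x<i = g (diag (1≤x , s≤s⁻¹ x<i) x∈)
      ... | inj₂ x≡i = f x≡i

    labels-assemble : ∀ {x} → [1⋯ k ] x → x ∈ labels (assemble k)
    labels-assemble {x} (1≤x , x≤k) = go k 1≤x x≤k (ℕ.m≤n+m k x)
      where
      -- Induction on a bound d for k ∸ x: a label of Bᵢ with i > x is reached through i.
      go : ∀ d {x} → 1 ≤ x → x ≤ k → k ≤ x + d → x ∈ labels (assemble k)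
      go d {x} 1≤x x≤k k≤x+d with covers (1≤x , x≤k)
      ... | i , i∈k@(1≤i , i≤k) , x∈Bi with m≤n⇒m<n∨m≡n (proj₂ (All.lookup (bounded i∈k) x∈Bi))
      ...   | inj₂ refl = proj₂ (on-assemble k ≤-refl) (1≤x , x≤k) x∈Bi
      ...   | inj₁ x<i with d
      ...     | zero  = contradiction
        (≤-trans x<i (≤-trans i≤k (subst (k ≤_) (ℕ.+-identityʳ x) k≤x+d))) (<-irrefl refl)
      ...     | suc d
        with k≤i+d ← ≤-trans k≤x+d (≤-trans (ℕ.≤-reflexive (ℕ.+-suc x d)) (ℕ.+-monoˡ-≤ d x<i))
        with p , e∈ ← on-label-block (proj₁ (on-assemble k ≤-refl)) (go d 1≤i i≤k k≤i+d) =
        ∈-resp-↭ (flatten-blocks (assemble k))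
          (∈-concat⁺′ (subst (x ∈_) (sym (All.lookup (matches-assemble k) e∈)) x∈Bi) (∈-map⁺ proj₂ e∈))

  -- If `B x` starts with x, the block of x in T is not strictly below x, so `on-block` puts x on
  -- the diagonal of T.
  assemble-unique : ∀ {k T} → OnDiag k T → (∀ {x} → [1⋯ k ] x → x ∈ labels T) →
                    Matches (blocks T) → T ≡ assemble k
  assemble-unique {k} {T} T-on complete ok = rebuild-on k T-on ok λ {x} x∈k (xs , eq) →
    let p , e∈ = on-label-block T-on (complete x∈k)
        p≡ = trans (All.lookup ok e∈) eq
    in [ (λ x∈ → x∈) , (λ p<x → ⊥-elim (<-irrefl refl (All.head (subst (All (_< x)) p≡ p<x)))) ]
         (proj₁ (proj₂ (on-block T-on e∈)))

-- Right paths in terms of nodes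

labels-inorder : ∀ T → map label (inorder T) ≡ labels T
labels-inorder empty        = refl
labels-inorder (node l m r) = begin
  map label (map left (inorder l) ++ root ∷ map right (inorder r))
    ≡⟨ map-++ label (map left (inorder l)) _ ⟩
  map label (map left (inorder l)) ++ m ∷ map label (map right (inorder r))
    ≡⟨ cong₂ (λ xs ys → xs ++ m ∷ ys) (map-∘ (inorder l)) (map-∘ (inorder r)) ⟨
  map label (inorder l) ++ m ∷ map label (inorder r)
    ≡⟨ cong₂ (λ xs ys → xs ++ m ∷ ys) (labels-inorder l) (labels-inorder r) ⟩
  labels l ++ m ∷ labels r ∎
  where open ≡-Reasoning

∈-inorder : ∀ {T} (v : Node T) → v ∈ inorder T
∈-inorder {node l _ _} root      = ∈-++⁺ʳ (map left (inorder l)) (here refl)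
∈-inorder              (left v)  = ∈-++⁺ˡ (∈-map⁺ left (∈-inorder v))
∈-inorder {node l _ _} (right v) = ∈-++⁺ʳ (map left (inorder l)) (there (∈-map⁺ right (∈-inorder v)))

label∈labels : ∀ {T} (v : Node T) → label v ∈ labels T
label∈labels {T} v = subst (label v ∈_) (labels-inorder T) (∈-map⁺ label (∈-inorder v))

labels⇒Labels : ∀ {T x} → x ∈ labels T → Labels T x
labels⇒Labels {T} {x} x∈
  with v , _ , x≡ ← ∈-map⁻ label (subst (x ∈_) (sym (labels-inorder T)) x∈) = v , sym x≡

HasLeft : ∀ {T} → Node T → Set
HasLeft v = ∃[ u ] lchild v ≡ just u

hasLeft? : ∀ {T} → Decidable (HasLeft {T})
hasLeft? v with lchild v
... | just u  = yes (u , refl)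
... | nothing = no λ ()

map-just⁻ : ∀ {A C : Set} {f : A → C} {c} x? → Maybe.map f x? ≡ just c → ∃[ x ] (x? ≡ just x × f x ≡ c)
map-just⁻ (just x) refl = x , refl , refl

module _ {l r : LTree} {m : ℕ} where

  private
    left′ : Node l → Node (node l m r)
    left′ = left
    right′ : Node r → Node (node l m r)
    right′ = right

  hasLeft-left⁺ : ∀ v → HasLeft v → HasLeft (left′ v)
  hasLeft-left⁺ v (u , eq) = left u , cong (Maybe.map left) eq

  hasLeft-left⁻ : ∀ v → HasLeft (left′ v) → HasLeft v
  hasLeft-left⁻ v (_ , eq) with u , eq′ , _ ← map-just⁻ (lchild v) eq = u , eq′

  hasLeft-right⁺ : ∀ v → HasLeft v → HasLeft (right′ v)
  hasLeft-right⁺ v (u , eq) = right u , cong (Maybe.map right) eq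

  hasLeft-right⁻ : ∀ v → HasLeft (right′ v) → HasLeft v
  hasLeft-right⁻ v (_ , eq) with u , eq′ , _ ← map-just⁻ (lchild v) eq = u , eq′

  asctops-left⁺ : ∀ v → asctops l v → asctops (node l m r) (left v)
  asctops-left⁺ v (inj₂ h) = inj₂ (hasLeft-left⁺ v h)
  asctops-left⁺ v (inj₁ h) with inorder l
  asctops-left⁺ v (inj₁ refl) | _ ∷ _ = inj₁ refl

  asctops-left⁻ : ∀ v → asctops (node l m r) (left v) → asctops l v
  asctops-left⁻ v (inj₂ h) = inj₂ (hasLeft-left⁻ v h)
  asctops-left⁻ v (inj₁ h) with inorder l
  asctops-left⁻ v (inj₁ refl) | _ ∷ _ = inj₁ refl

  asctops-right⁻ : ∀ v → asctops (node l m r) (right v) → HasLeft v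
  asctops-right⁻ v (inj₂ h) = hasLeft-right⁻ v h
  asctops-right⁻ v (inj₁ h) with inorder l
  asctops-right⁻ v (inj₁ ()) | []
  asctops-right⁻ v (inj₁ ()) | _ ∷ _

asctops-root : ∀ {l m r} → asctops (node l m r) root
asctops-root {empty}      = inj₁ refl
asctops-root {node _ _ _} = inj₂ (left root , refl)

hasLeft-root⁺ : ∀ {l m r} → NonEmpty l → HasLeft (root {l} {m} {r})
hasLeft-root⁺ nonEmpty = left root , refl

hasLeft-root⁻ : ∀ {l m r} → HasLeft (root {l} {m} {r}) → NonEmpty l
hasLeft-root⁻ {node _ _ _} _ = nonEmpty

-- Moves a filtered traversal along the embedding of a subtree. The values need to agree on selected
-- nodes only; `entry-right` below holds just for nodes with a left child.
collect-map : ∀ {A C D : Set} {P : A → Set} {Q : C → Set} (P? : Decidable P) (Q? : Decidable Q)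
              (f : A → C) {d : A → D} {e : C → D} →
              (∀ v → P v → Q (f v)) → (∀ v → Q (f v) → P v) → (∀ v → P v → e (f v) ≡ d v) →
              ∀ vs → map e (filter Q? (map f vs)) ≡ map d (filter P? vs)
collect-map P? Q? f P⇒Q Q⇒P e≡d []       = refl
collect-map P? Q? f P⇒Q Q⇒P e≡d (v ∷ vs) with P? v | Q? (f v)
... | yes Pv | yes _  = cong₂ _∷_ (e≡d v Pv) (collect-map P? Q? f P⇒Q Q⇒P e≡d vs)
... | no  _  | no  _  = collect-map P? Q? f P⇒Q Q⇒P e≡d vs
... | yes Pv | no ¬Qv = contradiction (P⇒Q v Pv) ¬Qv
... | no ¬Pv | yes Qv = contradiction (Q⇒P v Qv) ¬Pv

labels-rspine : ∀ T → map label (rspine T) ≡ spine T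
labels-rspine empty        = refl
labels-rspine (node _ m r) = cong (m ∷_) (trans (sym (map-∘ (rspine r))) (labels-rspine r))

lchild≢root : ∀ {l m r} (u : Node (node l m r)) → lchild u ≢ just root
lchild≢root (root {l = l}) eq with _ , _ , () ← map-just⁻ (rootOf l) eq
lchild≢root (left u)       eq with _ , _ , () ← map-just⁻ (lchild u) eq
lchild≢root (right u)      eq with _ , _ , () ← map-just⁻ (lchild u) eq

-- `root` is a node of r only once r is known to be a `node`, hence the transport in the hypothesis.
extend≡map : ∀ {l m r} ws →
             (∀ {l′ m′ r′} (eq : r ≡ node l′ m′ r′) → head ws ≢ just (subst Node (sym eq) root)) →
             extend {l} {m} {r} ws ≡ map right ws
extend≡map []            _    = refl
extend≡map (root ∷ _)    head≢ = contradiction refl (head≢ refl)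
extend≡map (left _ ∷ _)  _    = refl
extend≡map (right _ ∷ _) _    = refl

-- A left child is not a right child, so its right path starts at itself, never at the root, and
-- `extend` adds nothing. On entering a right subtree each of the two statements uses the other.
head-rpath-lchild : ∀ {T} (v : Node T) {u} → lchild v ≡ just u → head (rpath u) ≡ just u
rpath-right-lchild : ∀ {l m r} (v : Node r) {u} → lchild v ≡ just u →
                     rpath (right {l} {m} {r} u) ≡ map right (rpath u)

head-rpath-lchild (root {l = node _ _ _}) refl = refl
head-rpath-lchild (left v)  eq with u , eq′ , refl ← map-just⁻ (lchild v) eq =
  trans (head-map (rpath u)) (cong (Maybe.map left) (head-rpath-lchild v eq′))
head-rpath-lchild (right v) eq with u , eq′ , refl ← map-just⁻ (lchild v) eq =
  trans (cong head (rpath-right-lchild v eq′))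
        (trans (head-map (rpath u)) (cong (Maybe.map right) (head-rpath-lchild v eq′)))

rpath-right-lchild v {u} eq = extend≡map (rpath u) λ { refl head≡ →
  lchild≢root v (trans eq (trans (sym (head-rpath-lchild v eq)) head≡)) }

offEntry : ∀ {T} → Node T → ℕ × List ℕ
offEntry v = label v , maybe′ (map label ∘ rpath) [] (lchild v)

offBlocks-inorder : ∀ T → map offEntry (filter hasLeft? (inorder T)) ≡ offBlocks T
offBlocks-inorder empty = refl
offBlocks-inorder T@(node l m r) = begin
  map offEntry (filter hasLeft? (map left (inorder l) ++ root ∷ map right (inorder r)))
    ≡⟨ cong (map offEntry) (filter-++ hasLeft? (map left (inorder l)) _) ⟩
  map offEntry (filter hasLeft? (map left (inorder l))
    ++ filter hasLeft? (root ∷ map right (inorder r)))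
    ≡⟨ map-++ offEntry (filter hasLeft? (map left (inorder l))) _ ⟩
  map offEntry (filter hasLeft? (map left (inorder l)))
    ++ map offEntry (filter hasLeft? (root ∷ map right (inorder r)))
    ≡⟨ cong₂ _++_
         (trans (collect-map hasLeft? hasLeft? left hasLeft-left⁺ hasLeft-left⁻ entry-left (inorder l))
                (offBlocks-inorder l))
         (trans (at-root l _) (cong (attach m l ++_) (trans
           (collect-map hasLeft? hasLeft? right hasLeft-right⁺ hasLeft-right⁻ entry-right (inorder r))
           (offBlocks-inorder r)))) ⟩
  offBlocks T ∎
  where
  open ≡-Reasoning
  entry-left : ∀ v → HasLeft v → offEntry (left {l} {m} {r} v) ≡ offEntry v
  entry-left v (u , eq) rewrite eq = cong (label v ,_) (sym (map-∘ (rpath u)))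
  entry-right : ∀ v → HasLeft v → offEntry (right {l} {m} {r} v) ≡ offEntry v
  entry-right v (u , eq) rewrite eq =
    cong (label v ,_) (trans (cong (map label) (rpath-right-lchild v eq)) (sym (map-∘ (rpath u))))
  at-root : ∀ l (vs : List (Node (node l m r))) →
            map offEntry (filter hasLeft? (root ∷ vs)) ≡ attach m l ++ map offEntry (filter hasLeft? vs)
  at-root empty          vs = refl
  at-root l@(node _ _ _) vs =
    cong (λ xs → (m , xs) ∷ map offEntry (filter hasLeft? vs))
         (trans (sym (map-∘ (rspine l))) (labels-rspine l))

attachedPath-diag : ∀ {T} {v : Node T} → v ∈ diag T → attachedPath v ≡ rpath v
attachedPath-diag {T} {v} v∈ rewrite dec-true (∈?-with _≟_ v (diag T)) v∈ = refl

attachedPath-off : ∀ {T} {v : Node T} → v ∉ diag T → attachedPath v ≡ maybe′ rpath [] (lchild v)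
attachedPath-off {T} {v} v∉ rewrite dec-false (∈?-with _≟_ v (diag T)) v∉ = refl

entry : ∀ {T} → Node T → ℕ × List ℕ
entry v = label v , map label (attachedPath v)

-- The left subtree keeps its own asctops and diagonal. The right subtree meets neither the diagonal
-- nor v₁, so its asctops are the nodes with a left child.
blocks-inorder : ∀ T → map entry (filter (asctops? T) (inorder T)) ≡ blocks T
blocks-inorder empty = refl
blocks-inorder T@(node l m r) = begin
  map entry (filter (asctops? T) (map left (inorder l) ++ root ∷ map right (inorder r)))
    ≡⟨ cong (map entry) (filter-++ (asctops? T) (map left (inorder l)) _) ⟩
  map entry (filter (asctops? T) (map left (inorder l))
    ++ filter (asctops? T) (root ∷ map right (inorder r)))
    ≡⟨ map-++ entry (filter (asctops? T) (map left (inorder l))) _ ⟩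
  map entry (filter (asctops? T) (map left (inorder l)))
    ++ map entry (filter (asctops? T) (root ∷ map right (inorder r)))
    ≡⟨ cong₂ _++_
         (trans (collect-map (asctops? l) (asctops? T) left asctops-left⁺ asctops-left⁻
                  (λ v _ → entry-left v) (inorder l))
                (blocks-inorder l))
         (trans (cong (map entry) (filter-accept (asctops? T) asctops-root))
           (cong₂ _∷_ (cong (m ,_) (labels-rspine T)) (trans
             (collect-map hasLeft? (asctops? T) right (λ v → inj₂ ∘ hasLeft-right⁺ v) asctops-right⁻
               entry-right (inorder r))
             (offBlocks-inorder r)))) ⟩
  blocks T ∎
  where
  open ≡-Reasoning
  entry-left : ∀ v → entry (left {l} {m} {r} v) ≡ entry v
  entry-left v = cong (label v ,_) (go (∈?-with _≟_ v (diag l)))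
    where
    left∉ : v ∉ diag l → left v ∉ diag T
    left∉ v∉ (there v∈) with _ , v∈′ , refl ← ∈-map⁻ left v∈ = v∉ v∈′
    off : ∀ u? → map label (maybe′ rpath [] (Maybe.map (left {l} {m} {r}) u?))
               ≡ map label (maybe′ rpath [] u?)
    off nothing  = refl
    off (just u) = sym (map-∘ (rpath u))
    go : Dec (v ∈ diag l) → map label (attachedPath (left {l} {m} {r} v)) ≡ map label (attachedPath v)
    go (yes v∈) = trans (cong (map label) (attachedPath-diag (there (∈-map⁺ left v∈))))
                    (trans (sym (map-∘ (rpath v))) (cong (map label) (sym (attachedPath-diag v∈))))
    go (no v∉)  = trans (cong (map label) (attachedPath-off (left∉ v∉)))
                    (trans (off (lchild v)) (cong (map label) (sym (attachedPath-off v∉))))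
  entry-right : ∀ v → HasLeft v → entry (right {l} {m} {r} v) ≡ offEntry v
  entry-right v (u , eq) = trans (cong (λ ws → label v , map label ws) (attachedPath-off right∉)) via-lchild
    where
    right∉ : right v ∉ diag T
    right∉ (there v∈) with _ , _ , () ← ∈-map⁻ left v∈
    via-lchild : (label v , map label (maybe′ rpath [] (lchild (right {l} {m} {r} v)))) ≡ offEntry v
    via-lchild rewrite eq =
      cong (label v ,_) (trans (cong (map label) (rpath-right-lchild v eq)) (sym (map-∘ (rpath u))))

find : ℕ → Blocks → List ℕ
find i bs = maybe′ proj₂ [] (head (filter (λ e → proj₁ e ℕ.≟ i) bs))

find-∈ : ∀ {bs} → DistinctKeys bs → (x , p) ∈ bs → find x bs ≡ p
find-∈ {x} {bs = (x , _) ∷ bs} (_ ∷ _) (here refl)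
  rewrite dec-true (x ℕ.≟ x) refl = refl
find-∈ {x} {bs = (y , _) ∷ bs} (y≢ ∷ distinct) (there e∈)
  rewrite dec-false (y ℕ.≟ x) (All.lookup y≢ e∈) = find-∈ distinct e∈

find-map : ∀ {V A : Set} {P : V → Set} (P? : Decidable P)
           (key : V → ℕ) (path : V → List A) (f : A → ℕ) i vs →
           map f (maybe′ path [] (head (filter (λ v → P? v ×-dec (key v ℕ.≟ i)) vs)))
           ≡ find i (map (λ v → key v , map f (path v)) (filter P? vs))
find-map P? key path f i []       = refl
find-map P? key path f i (v ∷ vs) with does (P? v)
... | false = find-map P? key path f i vs
... | true  with does (key v ℕ.≟ i)
...   | true  = refl
...   | false = find-map P? key path f i vs

labels-W : ∀ T i → map label (W T i) ≡ find i (blocks T)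
labels-W T i =
  trans (find-map (asctops? T) label attachedPath label i (inorder T)) (cong (find i) (blocks-inorder T))

-- First occurrences and asctops

module _ {V : Set} (f : V → ℕ) where

  -- An inductive form of the condition on positions in `nub`, which splits along `_++_` and passes
  -- through `map`.
  data First (v : V) : List V → Set where
    here  : ∀ {vs} → First v (v ∷ vs)
    there : ∀ {u vs} → f u ≢ f v → First v vs → First v (u ∷ vs)

  first-lookup : ∀ {v} vs → First v vs →
    ∃[ j ] (lookup vs j ≡ v × (∀ i → i Fin.< j → f (lookup vs i) ≢ f (lookup vs j)))
  first-lookup (_ ∷ _)  here = zero , refl , λ _ ()
  first-lookup (_ ∷ vs) (there u≢v fst) with j , refl , new ← first-lookup vs fst =
    suc j , refl , λ { zero _ → u≢v ; (suc i) (s≤s i<j) → new i i<j }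

  lookup-first : ∀ vs j → (∀ i → i Fin.< j → f (lookup vs i) ≢ f (lookup vs j)) → First (lookup vs j) vs
  lookup-first (_ ∷ _)  zero    _   = here
  lookup-first (_ ∷ vs) (suc j) new =
    there (new zero (s≤s z≤n)) (lookup-first vs j λ i i<j → new (suc i) (s≤s i<j))

  first⇒∈ : ∀ {v vs} → First v vs → v ∈ vs
  first⇒∈ here          = here refl
  first⇒∈ (there _ fst) = there (first⇒∈ fst)

  first-++⁻ : ∀ {v} us {vs} → First v (us ++ vs) →
              First v us ⊎ All (λ u → f u ≢ f v) us × First v vs
  first-++⁻ []       fst           = inj₂ ([] , fst)
  first-++⁻ (_ ∷ _)  here          = inj₁ here
  first-++⁻ (_ ∷ us) (there u≢ fst) =
    ⊎-map (there u≢) (λ (us≢ , fst′) → u≢ ∷ us≢ , fst′) (first-++⁻ us fst)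

  first-++⁺ˡ : ∀ {v us vs} → First v us → First v (us ++ vs)
  first-++⁺ˡ here           = here
  first-++⁺ˡ (there u≢ fst) = there u≢ (first-++⁺ˡ fst)

  first-++⁺ʳ : ∀ {v us vs} → All (λ u → f u ≢ f v) us → First v vs → First v (us ++ vs)
  first-++⁺ʳ []         fst = fst
  first-++⁺ʳ (u≢ ∷ us≢) fst = there u≢ (first-++⁺ʳ us≢ fst)

first-map⁺ : ∀ {U V : Set} {f : U → ℕ} {g : V → ℕ} (h : U → V) → (∀ u → g (h u) ≡ f u) →
             ∀ {v us} → First f v us → First g (h v) (map h us)
first-map⁺ h eq here                     = here
first-map⁺ h eq {v} (there {u} u≢ fst) =
  there (λ e → u≢ (trans (sym (eq u)) (trans e (eq v)))) (first-map⁺ h eq fst)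

first-map⁻ : ∀ {U V : Set} {f : U → ℕ} {g : V → ℕ} (h : U → V) → (∀ u → g (h u) ≡ f u) →
             (∀ {u v} → h u ≡ h v → u ≡ v) →
             ∀ {v} us → First g (h v) (map h us) → First f v us
first-map⁻ {f = f} {g} h eq inj {v} (u ∷ us) fst = go fst refl
  where
  -- The node is generalised to w because matching on `here` could not unify `h v` with `h u`.
  go : ∀ {w} → First g w (map h (u ∷ us)) → w ≡ h v → First f v (u ∷ us)
  go here e with refl ← inj e = here
  go (there u≢ fst) refl = there (λ e → u≢ (trans (eq u) (trans e (sym (eq v))))) (first-map⁻ h eq inj us fst)

-- The labels visited before v, if those in S are visited before the tree.
seen : ∀ {T} → List ℕ → Node T → List ℕ
seen S (root {l = l})          = labels l ++ S
seen S (left v)                = seen S v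
seen S (right {l = l} {m} v) = seen (m ∷ labels l ++ S) v

S⊆seen : ∀ {T S x} (v : Node T) → x ∈ S → x ∈ seen S v
S⊆seen (root {l = l})  x∈ = ∈-++⁺ʳ (labels l) x∈
S⊆seen (left v)        x∈ = S⊆seen v x∈
S⊆seen (right {l = l} v) x∈ = S⊆seen v (there (∈-++⁺ʳ (labels l) x∈))

all-label≢⁺ : ∀ {x} T → x ∉ labels T → All (λ u → label u ≢ x) (inorder T)
all-label≢⁺ T x∉ = All.tabulate λ { {u} _ refl → x∉ (label∈labels u) }

all-label≢⁻ : ∀ {x T} → All (λ u → label u ≢ x) (inorder T) → x ∉ labels T
all-label≢⁻ all≢ x∈ with v , eq ← labels⇒Labels x∈ = All.lookup all≢ (∈-inorder v) eq

-- Together with `unseen⇒first`, this replaces positions in the traversal by the list accumulated on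
-- the way down to v, the form in which `OffDiag` records first visits.
first⇒unseen : ∀ {T} (v : Node T) → First label v (inorder T) → label v ∉ S → label v ∉ seen S v
first⇒unseen (root {l} {m} {r}) fst m∉S with first-++⁻ label (map left (inorder l)) fst
... | inj₁ fst′ with _ , _ , () ← ∈-map⁻ left (first⇒∈ label fst′)
... | inj₂ (l≢ , _) = λ m∈ → [ all-label≢⁻ (All.map⁻ l≢) , m∉S ] (∈-++⁻ (labels l) m∈)
first⇒unseen (left {l} {m} {r} v) fst v∉S with first-++⁻ label (map left (inorder l)) fst
... | inj₁ fst′ = first⇒unseen v (first-map⁻ left (λ _ → refl) (λ { refl → refl }) (inorder l) fst′) v∉S
... | inj₂ (_ , there _ fst′) with _ , _ , () ← ∈-map⁻ right (first⇒∈ label fst′)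
first⇒unseen (right {l} {m} {r} v) fst v∉S with first-++⁻ label (map left (inorder l)) fst
... | inj₁ fst′ with _ , _ , () ← ∈-map⁻ left (first⇒∈ label fst′)
... | inj₂ (l≢ , there m≢ fst′) =
  first⇒unseen v (first-map⁻ right (λ _ → refl) (λ { refl → refl }) (inorder r) fst′) λ where
    (here eq)  → m≢ (sym eq)
    (there v∈) → [ all-label≢⁻ (All.map⁻ l≢) , v∉S ] (∈-++⁻ (labels l) v∈)

unseen⇒first : ∀ {T} (v : Node T) → label v ∉ seen S v → First label v (inorder T)
unseen⇒first (root {l} {m} {r}) unseen =
  first-++⁺ʳ label (All.map⁺ (all-label≢⁺ l (unseen ∘ ∈-++⁺ˡ))) here
unseen⇒first (left v) unseen = first-++⁺ˡ label (first-map⁺ left (λ _ → refl) (unseen⇒first v unseen))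
unseen⇒first (right {l} {m} {r} v) unseen =
  first-++⁺ʳ label (All.map⁺ (all-label≢⁺ l λ v∈ → unseen (S⊆seen v (there (∈-++⁺ˡ v∈)))))
    (there (λ { refl → unseen (S⊆seen v (here refl)) })
           (first-map⁺ right (λ _ → refl) (unseen⇒first v unseen)))

nub⇒unseen : ∀ {T} (v : Node T) → nub T v → label v ∉ seen [] v
nub⇒unseen {T} v (j , refl , new) = first⇒unseen v (lookup-first label (inorder T) j new) λ ()

unseen⇒nub : ∀ {T} (v : Node T) → label v ∉ seen [] v → nub T v
unseen⇒nub {T} v unseen = first-lookup label (inorder T) (unseen⇒first v unseen)

-- Fishburn trees as complete `OnDiag` trees

labels≤maxLabel : ∀ T → All (_≤ maxLabel T) (labels T)
labels≤maxLabel empty        = []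
labels≤maxLabel (node l m r) =
  All.++⁺
    (All.map (λ x≤ → ≤-trans x≤ (≤-trans (ℕ.m≤m⊔n _ _) (ℕ.m≤n⊔m m _))) (labels≤maxLabel l))
    (ℕ.m≤m⊔n m _ ∷
     All.map (λ x≤ → ≤-trans x≤ (≤-trans (ℕ.m≤n⊔m (maxLabel l) _) (ℕ.m≤n⊔m m _))) (labels≤maxLabel r))

maxLabel≤ : ∀ T → All (_≤ b) (labels T) → maxLabel T ≤ b
maxLabel≤ empty        _ = z≤n
maxLabel≤ (node l m r) a with l≤ , m≤ ∷ r≤ ← All.++⁻ (labels l) a =
  ℕ.⊔-lub m≤ (ℕ.⊔-lub (maxLabel≤ l l≤) (maxLabel≤ r r≤))

off-maxLabel : OffDiag S b T → maxLabel T ≤ b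
off-maxLabel {T = T} o = maxLabel≤ T (All.map proj₂ (off-label-bounds o))

on-maxLabel : OnDiag b T → maxLabel T ≤ b
on-maxLabel {T = T} o = maxLabel≤ T (All.map proj₂ (on-label-bounds o))

¬nonEmpty⇒leaf : ∀ l → ¬ NonEmpty l → l ≡ leaf tt
¬nonEmpty⇒leaf empty        _    = refl
¬nonEmpty⇒leaf (node _ _ _) ¬ne = contradiction nonEmpty ¬ne

-- The last two hypotheses pass to subtrees because `seen` unfolds along `left` and `right` exactly
-- as S changes in `OffDiag`.
off-intro : ∀ T → Decreasing T → StrictlyDecreasingLeft T → All (1 ≤_) (labels T) → maxLabel T ≤ b →
            (∀ (v : Node T) → label v ∉ seen S v → HasLeft v) →
            (∀ (v : Node T) → HasLeft v → label v ∉ seen S v) → OffDiag S b T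
off-intro empty _ _ _ _ _ _ = leaf
off-intro {b} {S} (node l m r) (l-dec , r-dec , l⊔r≤m) (l<m , l-strict , r-strict) positive T≤b unseen⇒ ⇒unseen
  -- Positivity exposes the root label as a successor; from here on m is its predecessor.
  with l-pos , s≤s {n = m} _ ∷ r-pos ← All.++⁻ (labels l) positive =
  node (≤-trans (ℕ.m≤m⊔n (suc m) (maxLabel l ⊔ maxLabel r)) T≤b) new
    (off-intro l l-dec l-strict l-pos (s≤s⁻¹ l<m)
      (λ v → hasLeft-left⁻ v ∘ unseen⇒ (left v)) (λ v → ⇒unseen (left v) ∘ hasLeft-left⁺ v))
    (off-intro r r-dec r-strict r-pos (≤-trans (ℕ.m≤n⊔m (maxLabel l) _) l⊔r≤m)
      (λ v → hasLeft-right⁻ v ∘ unseen⇒ (right v)) (λ v → ⇒unseen (right v) ∘ hasLeft-right⁺ v))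
  where
  new : suc m ∈ S × l ≡ leaf tt ⊎ suc m ∉ S × NonEmpty l
  new with suc m ∈? S
  -- The root label exceeds all labels of `l`, so it is unseen as soon as it is outside S.
  ... | no m∉S = inj₂ (m∉S , hasLeft-root⁻ (unseen⇒ root λ m∈ →
    [ (λ m∈l → <-irrefl refl (≤-trans l<m (All.lookup (labels≤maxLabel l) m∈l))) , m∉S ] (∈-++⁻ (labels l) m∈)))
  ... | yes m∈S = inj₁ (m∈S , ¬nonEmpty⇒leaf l λ ne →
    ⇒unseen root (hasLeft-root⁺ ne) (∈-++⁺ʳ (labels l) m∈S))

on-intro : ∀ T → Decreasing T → StrictlyDecreasingLeft T → All (1 ≤_) (labels T) → maxLabel T ≤ b →
           (∀ v → label v ∉ seen [] v → asctops T v) →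
           (∀ v → asctops T v → label v ∉ seen [] v) → OnDiag b T
on-intro empty _ _ _ _ _ _ = leaf
on-intro (node l m r) (l-dec , r-dec , l⊔r≤m) (l<m , l-strict , r-strict) positive T≤b unseen⇒ ⇒unseen
  with l-pos , s≤s {n = m} _ ∷ r-pos ← All.++⁻ (labels l) positive =
  node (≤-trans (ℕ.m≤m⊔n (suc m) (maxLabel l ⊔ maxLabel r)) T≤b)
    (on-intro l l-dec l-strict l-pos (s≤s⁻¹ l<m)
      (λ v → asctops-left⁻ v ∘ unseen⇒ (left v)) (λ v → ⇒unseen (left v) ∘ asctops-left⁺ v))
    (off-intro r r-dec r-strict r-pos (≤-trans (ℕ.m≤n⊔m (maxLabel l) _) l⊔r≤m)
      (λ v → asctops-right⁻ v ∘ unseen⇒ (right v)) (λ v → ⇒unseen (right v) ∘ inj₂ ∘ hasLeft-right⁺ v))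

off-decreasing : OffDiag S b T → Decreasing T × StrictlyDecreasingLeft T
off-decreasing leaf = tt , tt
off-decreasing (node _ _ l-off r-off)
  with l-dec , l-strict ← off-decreasing l-off | r-dec , r-strict ← off-decreasing r-off =
  (l-dec , r-dec , ℕ.⊔-lub (≤-trans (off-maxLabel l-off) (n≤1+n _)) (off-maxLabel r-off)) ,
  (s≤s (off-maxLabel l-off) , l-strict , r-strict)

on-decreasing : OnDiag b T → Decreasing T × StrictlyDecreasingLeft T
on-decreasing leaf = tt , tt
on-decreasing (node _ l-on r-off)
  with l-dec , l-strict ← on-decreasing l-on | r-dec , r-strict ← off-decreasing r-off =
  (l-dec , r-dec , ℕ.⊔-lub (≤-trans (on-maxLabel l-on) (n≤1+n _)) (off-maxLabel r-off)) ,
  (s≤s (on-maxLabel l-on) , l-strict , r-strict)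

off-unseen⇒hasLeft : ∀ {T} → OffDiag S b T → (v : Node T) → label v ∉ seen S v → HasLeft v
off-unseen⇒hasLeft {S} (node {l} _ (inj₁ (m∈S , _)) _ _) root unseen =
  contradiction (∈-++⁺ʳ (labels l) m∈S) unseen
off-unseen⇒hasLeft (node _ (inj₂ (_ , ne)) _ _) root unseen = hasLeft-root⁺ ne
off-unseen⇒hasLeft (node _ _ l-off _) (left v)  unseen = hasLeft-left⁺ v (off-unseen⇒hasLeft l-off v unseen)
off-unseen⇒hasLeft (node _ _ _ r-off) (right v) unseen = hasLeft-right⁺ v (off-unseen⇒hasLeft r-off v unseen)

off-hasLeft⇒unseen : ∀ {T} → OffDiag S b T → (v : Node T) → HasLeft v → label v ∉ seen S v
off-hasLeft⇒unseen (node _ (inj₁ (_ , refl)) _ _) root (_ , ())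
off-hasLeft⇒unseen (node {l} _ (inj₂ (m∉S , _)) l-off _) root _ m∈ =
  [ (λ m∈l → <-irrefl refl (proj₂ (All.lookup (off-label-bounds l-off) m∈l))) , m∉S ] (∈-++⁻ (labels l) m∈)
off-hasLeft⇒unseen (node _ _ l-off _) (left v)  h = off-hasLeft⇒unseen l-off v (hasLeft-left⁻ v h)
off-hasLeft⇒unseen (node _ _ _ r-off) (right v) h = off-hasLeft⇒unseen r-off v (hasLeft-right⁻ v h)

on-unseen⇒asctops : ∀ {T} → OnDiag b T → (v : Node T) → label v ∉ seen [] v → asctops T v
on-unseen⇒asctops (node _ _ _)     root      _      = asctops-root
on-unseen⇒asctops (node _ l-on _)  (left v)  unseen = asctops-left⁺ v (on-unseen⇒asctops l-on v unseen)
on-unseen⇒asctops (node _ _ r-off) (right v) unseen = inj₂ (hasLeft-right⁺ v (off-unseen⇒hasLeft r-off v unseen))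

on-asctops⇒unseen : ∀ {T} → OnDiag b T → (v : Node T) → asctops T v → label v ∉ seen [] v
on-asctops⇒unseen (node {l} _ l-on _) root _ m∈ =
  [ (λ m∈l → <-irrefl refl (proj₂ (All.lookup (on-label-bounds l-on) m∈l))) , (λ ()) ] (∈-++⁻ (labels l) m∈)
on-asctops⇒unseen (node _ l-on _)  (left v)  asc = on-asctops⇒unseen l-on v (asctops-left⁻ v asc)
on-asctops⇒unseen (node _ _ r-off) (right v) asc = off-hasLeft⇒unseen r-off v (asctops-right⁻ v asc)

-- If the maximum did not occur, its predecessor would already bound all labels.
maxLabel∈labels : ∀ T → 1 ≤ maxLabel T → maxLabel T ∈ labels T
maxLabel∈labels T 1≤M with maxLabel T ∈? labels T
... | yes M∈ = M∈
... | no  M∉ = contradiction (maxLabel≤ T (All.tabulate λ x∈ →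
    ℕ.<⇒≤pred (≤∧≢⇒< (All.lookup (labels≤maxLabel T) x∈) λ { refl → M∉ x∈ })))
  (ℕ.<⇒≱ (ℕ.≤-reflexive (ℕ.suc-pred (maxLabel T) {{>-nonZero 1≤M}})))

fishburn⇒on : IsFishburnTree T → OnDiag (maxLabel T) T × (∀ {x} → [1⋯ maxLabel T ] x → x ∈ labels T)
fishburn⇒on {T} fishburn =
  on-intro T decreasing strictlyLeft positive ≤-refl
    (λ v → proj₁ nub≐asctops ∘ unseen⇒nub v) (λ v → nub⇒unseen v ∘ proj₂ nub≐asctops) ,
  complete
  where
  open IsFishburnTree fishburn
  open IsEndotree isEndotree
  positive : All (1 ≤_) (labels T)
  positive = All.tabulate λ x∈ → let v , eq = labels⇒Labels x∈ in
    subst (1 ≤_) eq (proj₁ (labelsInRange v))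
  complete : ∀ {x} → [1⋯ maxLabel T ] x → x ∈ labels T
  complete (1≤x , x≤M) with k , _ , Labels⇒ , ⇒Labels ← isRegular
    -- The maximal label occurs, so it is at most the k given by regularity.
    with _ , M≤k ← Labels⇒ (labels⇒Labels {T} (maxLabel∈labels T (≤-trans 1≤x x≤M)))
    with v , refl ← ⇒Labels (1≤x , ≤-trans x≤M M≤k) = label∈labels v

on⇒maxLabel : ∀ k → OnDiag k T → (∀ {x} → [1⋯ k ] x → x ∈ labels T) → maxLabel T ≡ k
on⇒maxLabel zero    T-on _ = ℕ.n≤0⇒n≡0 (on-maxLabel T-on)
on⇒maxLabel {T} (suc k) T-on complete =
  ℕ.≤-antisym (on-maxLabel T-on) (All.lookup (labels≤maxLabel T) (complete (s≤s z≤n , ≤-refl)))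

module _ {k : ℕ} (T-on : OnDiag k T) (complete : ∀ {x} → [1⋯ k ] x → x ∈ labels T) where

  -- Both lists are free of duplicates, every label has a block, and every key is a label.
  keys↭ : List.tabulate {n = k} (suc ∘ toℕ) ↭ map proj₁ (blocks T)
  keys↭ = ∼bag⇒↭ (unique∧set⇒bag
    (Unique.tabulate⁺ (Fin.toℕ-injective ∘ ℕ.suc-injective))
    (AllPairs.map⁺ (on-distinct T-on))
    (mk⇔ to from))
    where
    to : x ∈ List.tabulate {n = k} (suc ∘ toℕ) → x ∈ map proj₁ (blocks T)
    to x∈ with i , refl ← ∈-tabulate⁻ x∈ =
      let _ , e∈ = on-label-block T-on (complete (s≤s z≤n , Fin.toℕ<n i)) in ∈-map⁺ proj₁ e∈
    from : x ∈ map proj₁ (blocks T) → x ∈ List.tabulate {n = k} (suc ∘ toℕ)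
    from x∈ with _ , e∈ , refl ← ∈-map⁻ proj₁ x∈
      with s≤s {n = x} _ , x≤k ← All.lookup (on-label-bounds T-on) (blocks-key T e∈) =
      subst (λ y → suc y ∈ _) (Fin.toℕ-fromℕ< x≤k) (∈-tabulate⁺ (Fin.fromℕ< x≤k))

  -- There is one block per label and at most one block per node.
  k≤#nodes : k ≤ #nodes T
  k≤#nodes = begin
    k                                          ≡⟨ length-tabulate {n = k} (suc ∘ toℕ) ⟨
    length (List.tabulate {n = k} (suc ∘ toℕ)) ≡⟨ ↭-length keys↭ ⟩
    length (map proj₁ (blocks T))              ≡⟨ length-map proj₁ (blocks T) ⟩
    length (blocks T)                          ≤⟨ length-blocks T ⟩
    #nodes T                                   ∎
    where open ℕ.≤-Reasoning

  on⇒fishburn : IsFishburnTree T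
  on⇒fishburn = record
    { isEndotree  = record
      { decreasing    = proj₁ (on-decreasing T-on)
      ; strictlyLeft  = proj₂ (on-decreasing T-on)
      ; labelsInRange = λ v →
          let 1≤ , ≤k = All.lookup (on-label-bounds T-on) (label∈labels v) in 1≤ , ≤-trans ≤k k≤#nodes
      }
    ; isRegular   = k , k≤#nodes ,
      (λ (v , eq) → subst [1⋯ k ] eq (All.lookup (on-label-bounds T-on) (label∈labels v))) ,
      λ x∈k → labels⇒Labels (complete x∈k)
    ; nub≐asctops =
      (λ {v} n → on-unseen⇒asctops T-on v (nub⇒unseen v n)) ,
      (λ {v} a → unseen⇒nub v (on-asctops⇒unseen T-on v a))
    }

-- Multiplicities and matrices

count : ℕ → List ℕ → ℕ
count x xs = length (filter (ℕ._≟ x) xs)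

count-++ : ∀ x xs ys → count x (xs ++ ys) ≡ count x xs + count x ys
count-++ x xs ys = trans (cong length (filter-++ (ℕ._≟ x) xs ys)) (length-++ (filter (ℕ._≟ x) xs))

count-∉ : ∀ {x xs} → x ∉ xs → count x xs ≡ 0
count-∉ {x} {xs} x∉ = cong length (filter-none (ℕ._≟ x) (All.tabulate {xs = xs} λ { y∈ refl → x∉ y∈ }))

count-∈ : ∀ {x xs} → x ∈ xs → count x xs ≢ 0
count-∈ {x} {xs} x∈ eq with () ← subst (0 <_) eq (filter-some (ℕ._≟ x) (Any.map sym x∈))

count≢0⇒∈ : ∀ {x xs} → count x xs ≢ 0 → x ∈ xs
count≢0⇒∈ {x} {xs} ≢0 with x ∈? xs
... | yes x∈ = x∈
... | no  x∉ = contradiction (count-∉ x∉) ≢0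

count-↭ : ∀ {xs ys} x → xs ↭ ys → count x xs ≡ count x ys
count-↭ x xs↭ys = ↭-length (filter-↭ (ℕ._≟ x) xs↭ys)

count-∷-injective : ∀ {x y xs ys} → count y (x ∷ xs) ≡ count y (x ∷ ys) → count y xs ≡ count y ys
count-∷-injective {x} {y} eq with does (x ℕ.≟ y)
... | true  = ℕ.suc-injective eq
... | false = eq

-- The head of `xs` has positive count in `ys`, so it can be moved to the front there and cancelled.
count-ext : ∀ xs ys → (∀ x → count x xs ≡ count x ys) → xs ↭ ys
count-ext [] [] _ = ↭-refl
count-ext [] (y ∷ ys) eq = contradiction (sym (eq y)) (count-∈ {y} {y ∷ ys} (here refl))
count-ext (x ∷ xs) ys eq
  with as , bs , refl ← ∈-∃++ (count≢0⇒∈ {x} {ys} (count-∈ {x} {x ∷ xs} (here refl) ∘ trans (eq x))) =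
  ↭-trans (prep x (count-ext xs (as ++ bs) λ y →
            count-∷-injective {x} {y} {xs} {as ++ bs} (trans (eq y) (count-↭ y (shift x as bs)))))
          (↭-sym (shift x as bs))

count-map : ∀ {A : Set} (f : A → ℕ) x us → length (filter (λ u → f u ℕ.≟ x) us) ≡ count x (map f us)
count-map f x []       = refl
count-map f x (u ∷ us) with does (f u ℕ.≟ x)
... | true  = cong suc (count-map f x us)
... | false = count-map f x us

module _ {A : Set} where

  copies : ∀ {k} → (Fin k → ℕ) → (Fin k → A) → List A
  copies a g = concat (tabulate λ j → replicate (a j) (g j))

  ∈-copies⁻ : ∀ {k x} (a : Fin k → ℕ) g → x ∈ copies a g → ∃[ j ] (x ≡ g j × a j ≢ 0)
  ∈-copies⁻ a g x∈ with _ , x∈r , r∈ ← ∈-concat⁻′ (tabulate λ j → replicate (a j) (g j)) x∈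
    with j , refl ← ∈-tabulate⁻ r∈ =
    j , All.lookup (All.replicate⁺ {P = _≡ g j} (a j) refl) x∈r , nonzero (a j) x∈r
    where
    nonzero : ∀ {x y : A} n → x ∈ replicate n y → n ≢ 0
    nonzero (suc _) _ ()

  ∈-copies⁺ : ∀ {k} (a : Fin k → ℕ) g j → a j ≢ 0 → g j ∈ copies a g
  ∈-copies⁺ a g j a≢0 = ∈-concat⁺′ (g∈ (a j) a≢0) (∈-tabulate⁺ j)
    where
    g∈ : ∀ n → n ≢ 0 → g j ∈ replicate n (g j)
    g∈ zero    n≢0 = contradiction refl n≢0
    g∈ (suc _) _   = here refl

count-copies : ∀ {k} (a : Fin k → ℕ) (g : Fin k → ℕ) → (∀ {i j} → g i ≡ g j → i ≡ j) →
               ∀ j → count (g j) (copies a g) ≡ a j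
count-copies {suc k} a g inj zero = begin
  count (g zero) (replicate (a zero) (g zero) ++ copies (a ∘ suc) (g ∘ suc))
    ≡⟨ count-++ (g zero) (replicate (a zero) (g zero)) _ ⟩
  count (g zero) (replicate (a zero) (g zero)) + count (g zero) (copies (a ∘ suc) (g ∘ suc))
    ≡⟨ cong₂ _+_
         (trans (cong length (filter-all (ℕ._≟ g zero) (All.replicate⁺ (a zero) refl)))
                (length-replicate (a zero)))
         (count-∉ λ g∈ → case (∈-copies⁻ (a ∘ suc) (g ∘ suc) g∈)) ⟩
  a zero + 0 ≡⟨ ℕ.+-identityʳ (a zero) ⟩
  a zero ∎
  where
  open ≡-Reasoning
  case : ¬ (∃[ j ] (g zero ≡ g (suc j) × a (suc j) ≢ 0))
  case (j , eq , _) with () ← inj eq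
count-copies {suc k} a g inj (suc j) = begin
  count (g (suc j)) (replicate (a zero) (g zero) ++ copies (a ∘ suc) (g ∘ suc))
    ≡⟨ count-++ (g (suc j)) (replicate (a zero) (g zero)) _ ⟩
  count (g (suc j)) (replicate (a zero) (g zero)) + count (g (suc j)) (copies (a ∘ suc) (g ∘ suc))
    ≡⟨ cong₂ _+_ (count-∉ λ g∈ → case (All.lookup (All.replicate⁺ {P = _≡ g zero} (a zero) refl) g∈))
                 (count-copies (a ∘ suc) (g ∘ suc) (Fin.suc-injective ∘ inj) j) ⟩
  a (suc j) ∎
  where
  open ≡-Reasoning
  case : g (suc j) ≢ g zero
  case eq with () ← inj eq

-- At `A ⟨ i ,_⟩` this is definitionally the i-th list of `rowMultisets A`.
row : ∀ {k} → (Fin k → ℕ) → List ℕ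
row a = copies a (suc ∘ toℕ)

suc-toℕ-injective : ∀ {k} {i j : Fin k} → suc (toℕ i) ≡ suc (toℕ j) → i ≡ j
suc-toℕ-injective = Fin.toℕ-injective ∘ ℕ.suc-injective

suc-toℕ-surjective : ∀ {k x} → [1⋯ k ] x → ∃[ i ] x ≡ suc (toℕ {k} i)
suc-toℕ-surjective (s≤s _ , x≤k) = Fin.fromℕ< x≤k , cong suc (sym (Fin.toℕ-fromℕ< x≤k))

[1⋯]-suc-toℕ : ∀ {k} (i : Fin k) → [1⋯ k ] (suc (toℕ i))
[1⋯]-suc-toℕ i = s≤s z≤n , Fin.toℕ<n i

-- Members of `ws` are of the form `suc (toℕ j)`, where `count-copies` applies; all other numbers
-- have count zero on both sides.
row-count : ∀ {k ws} → All [1⋯ k ] ws → row {k} (λ j → count (suc (toℕ j)) ws) ↭ ws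
row-count {k} {ws} ws≤k = count-ext _ ws λ x → go x (x ∈? ws)
  where
  a : Fin k → ℕ
  a j = count (suc (toℕ j)) ws
  go : ∀ x → Dec (x ∈ ws) → count x (row a) ≡ count x ws
  go x (yes x∈) with j , refl ← suc-toℕ-surjective (All.lookup ws≤k x∈) =
    count-copies a (suc ∘ toℕ) suc-toℕ-injective j
  go x (no x∉) = trans (count-∉ λ x∈ → contradiction (∈-copies⁻ a (suc ∘ toℕ) x∈) λ where
    (j , refl , a≢0) → a≢0 (count-∉ x∉)) (sym (count-∉ x∉))

-- Sorted rows and the tree of a matrix

≥-decTotalOrder : DecTotalOrder _ _ _
≥-decTotalOrder = Flip.decTotalOrder ℕ.≤-decTotalOrder

open Sort ≥-decTotalOrder using (sort; sort-↭; sort-↗)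

sort-sorted : ∀ xs → AllPairs _≥_ (sort xs)
sort-sorted xs = Sorted⇒AllPairs (DecTotalOrder.totalOrder ≥-decTotalOrder) (sort-↗ xs)

sorted↭⇒≡ : ∀ {xs ys} → AllPairs _≥_ xs → AllPairs _≥_ ys → xs ↭ ys → xs ≡ ys
sorted↭⇒≡ xs↘ ys↘ xs↭ys =
  ≋⇒≡ (↗↭↗⇒≋ O (AllPairs⇒Sorted O xs↘) (AllPairs⇒Sorted O ys↘) (↭⇒↭ₛ xs↭ys))
  where O = DecTotalOrder.totalOrder ≥-decTotalOrder

rowAt : Multisets → ℕ → List ℕ
rowAt []       _       = []
rowAt (B ∷ _)  zero    = B
rowAt (_ ∷ Bs) (suc i) = rowAt Bs i

rowAt-tabulate : ∀ {k} (f : Fin k → List ℕ) i → rowAt (tabulate f) (toℕ i) ≡ f i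
rowAt-tabulate f zero    = refl
rowAt-tabulate f (suc i) = rowAt-tabulate (f ∘ suc) i

-- Labels start at 1 and rows at 0, hence `pred`; `IsFamily k` constrains the values on [k] only.
matrixFamily : ∃ Matrix → ℕ → List ℕ
matrixFamily (_ , A) x = sort (rowAt (rowMultisets A) (pred x))

matrixFamily-↭ : ∀ {k} (A : Matrix k) i → matrixFamily (k , A) (suc (toℕ i)) ↭ row (A ⟨ i ,_⟩)
matrixFamily-↭ A i = ↭-trans (sort-↭ _) (↭-reflexive (rowAt-tabulate (λ i → row (A ⟨ i ,_⟩)) i))

-- It depends on the matrix alone and not on a proof that it is Fishburn, so β̄ respects setoid
-- equality by `cong`.
tree : ∃ Matrix → LTree
tree A = assemble (proj₁ A)
  where open Construction (matrixFamily A)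

module _ {k} {A : Matrix k} (fishburn : IsFishburnMatrix A) where
  open IsFishburnMatrix fishburn
  open Construction (matrixFamily (k , A))

  -- Nonzero rows give nonempty lists, triangularity gives the bound, and nonzero columns give the
  -- covering.
  matrixFamily-isFamily : IsFamily k
  matrixFamily-isFamily = record
    { nonempty = λ x∈k → nonempty′ (suc-toℕ-surjective x∈k)
    ; bounded  = λ x∈k → bounded′ (suc-toℕ-surjective x∈k)
    ; sorted   = λ _ → sort-sorted _
    ; covers   = λ y∈k → covers′ (suc-toℕ-surjective y∈k)
    }
    where
    nonempty′ : ∀ {x} → ∃[ i ] x ≡ suc (toℕ {k} i) → matrixFamily (k , A) x ≢ []
    nonempty′ (i , refl) eq with j , A≢0 ← row≢0 i
      with () ← subst (suc (toℕ j) ∈_) eq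
        (∈-resp-↭ (↭-sym (matrixFamily-↭ A i)) (∈-copies⁺ (A ⟨ i ,_⟩) (suc ∘ toℕ) j A≢0))
    bounded′ : ∀ {x} → ∃[ i ] x ≡ suc (toℕ {k} i) → All [1⋯ x ] (matrixFamily (k , A) x)
    bounded′ (i , refl) = All.tabulate λ y∈ →
      case (∈-copies⁻ (A ⟨ i ,_⟩) (suc ∘ toℕ) (∈-resp-↭ (matrixFamily-↭ A i) y∈))
      where
      case : ∀ {y} → ∃[ j ] (y ≡ suc (toℕ j) × A ⟨ i , j ⟩ ≢ 0) → [1⋯ suc (toℕ i) ] y
      case (j , refl , A≢0) = s≤s z≤n , s≤s (ℕ.≮⇒≥ (A≢0 ∘ lowerTriangular i j))
    covers′ : ∀ {y} → ∃[ j ] y ≡ suc (toℕ {k} j) → ∃[ x ] [1⋯ k ] x × y ∈ matrixFamily (k , A) x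
    covers′ (j , refl) with i , A≢0 ← column≢0 j =
      suc (toℕ i) , [1⋯]-suc-toℕ i ,
      ∈-resp-↭ (↭-sym (matrixFamily-↭ A i)) (∈-copies⁺ (A ⟨ i ,_⟩) (suc ∘ toℕ) j A≢0)

  tree-on : OnDiag k (tree (k , A))
  tree-on = proj₁ (on-assemble matrixFamily-isFamily k ≤-refl)

  tree-complete : ∀ {x} → [1⋯ k ] x → x ∈ labels (tree (k , A))
  tree-complete = labels-assemble matrixFamily-isFamily

  tree-isFishburn : IsFishburnTree (tree (k , A))
  tree-isFishburn = on⇒fishburn tree-on tree-complete

  maxLabel-tree : maxLabel (tree (k , A)) ≡ k
  maxLabel-tree = on⇒maxLabel k tree-on tree-complete

  find-tree : ∀ i → find (suc (toℕ i)) (blocks (tree (k , A))) ↭ row (A ⟨ i ,_⟩)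
  find-tree i with p , e∈ ← on-label-block tree-on (tree-complete ([1⋯]-suc-toℕ i)) =
    ↭-trans (↭-reflexive (trans (find-∈ (on-distinct tree-on) e∈) (All.lookup (matches-assemble k) e∈)))
            (matrixFamily-↭ A i)

  tree-isβ̄ : 𝔓 (tree (k , A)) ≋ rowMultisets A
  tree-isβ̄ = go {f = λ x → map label (W (tree (k , A)) x)} maxLabel-tree λ i →
    ↭-trans (↭-reflexive (labels-W (tree (k , A)) (suc (toℕ i)))) (find-tree i)
    where
    -- The length is generalised to n because k also occurs inside `tree (k , A)`, so
    -- `maxLabel-tree` cannot be matched with `refl`.
    go : ∀ {n} {f : ℕ → List ℕ} {g : Fin k → List ℕ} → n ≡ k → (∀ i → f (suc (toℕ i)) ↭ g i) →
         tabulate {n = n} (λ i → f (suc (toℕ i))) ≋ tabulate g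
    go refl f↭g = Pointwise.tabulate⁺ f↭g

matrix-ext : ∀ {k} {f : Fin k → Fin k → ℕ} {A : Matrix k} → (∀ i j → f i j ≡ A ⟨ i , j ⟩) →
             Vec.tabulate (λ i → Vec.tabulate (f i)) ≡ A
matrix-ext {A = A} f≡A = trans
  (Vec.tabulate-cong λ i → trans (Vec.tabulate-cong (f≡A i)) (Vec.tabulate∘lookup (Vec.lookup A i)))
  (Vec.tabulate∘lookup A)

-- Equal lengths of the two lists identify the dimensions, and entries are multiplicities in
-- corresponding multisets. Stated for any tree with these multisets, it serves both β ∘ β̄ and the
-- uniqueness of β̄.
isβ̄⇒β≡ : ∀ T {k} {A : Matrix k} → 𝔓 T ≋ rowMultisets A → (maxLabel T , β T) ≡ (k , A)
isβ̄⇒β≡ T {k} {A} 𝔓≋ 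
  with refl ← trans (sym (length-tabulate {n = k} _))
                (trans (sym (Pointwise-length 𝔓≋)) (length-tabulate {n = maxLabel T} _)) =
  cong (maxLabel T ,_) (matrix-ext λ i j → begin
  length (filter (λ u → label u ℕ.≟ suc (toℕ j)) (W T (suc (toℕ i))))
    ≡⟨ count-map label (suc (toℕ j)) (W T (suc (toℕ i))) ⟩
  count (suc (toℕ j)) (map label (W T (suc (toℕ i))))
    ≡⟨ count-↭ (suc (toℕ j)) (Pointwise.tabulate⁻ 𝔓≋ i) ⟩
  count (suc (toℕ j)) (row (A ⟨ i ,_⟩))
    ≡⟨ count-copies (A ⟨ i ,_⟩) (suc ∘ toℕ) suc-toℕ-injective j ⟩
  A ⟨ i , j ⟩ ∎)
  where
  open ≡-Reasoning

-- The matrix of a Fishburn tree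

β-entry : ∀ T i j → β T ⟨ i , j ⟩ ≡ count (suc (toℕ j)) (find (suc (toℕ i)) (blocks T))
β-entry T i j = begin
  β T ⟨ i , j ⟩
    ≡⟨ cong (λ v → Vec.lookup v j) (Vec.lookup∘tabulate _ i) ⟩
  Vec.lookup (Vec.tabulate {n = maxLabel T} _) j
    ≡⟨ Vec.lookup∘tabulate _ j ⟩
  length (filter (λ u → label u ℕ.≟ suc (toℕ j)) (W T (suc (toℕ i))))
    ≡⟨ count-map label (suc (toℕ j)) (W T (suc (toℕ i))) ⟩
  count (suc (toℕ j)) (map label (W T (suc (toℕ i))))
    ≡⟨ cong (count (suc (toℕ j))) (labels-W T (suc (toℕ i))) ⟩
  count (suc (toℕ j)) (find (suc (toℕ i)) (blocks T)) ∎
  where open ≡-Reasoning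

module _ {T : LTree} (fishburn : IsFishburnTree T) where
  private
    M = maxLabel T
    T-on : OnDiag M T
    T-on = proj₁ (fishburn⇒on fishburn)
    complete : ∀ {x} → [1⋯ M ] x → x ∈ labels T
    complete = proj₂ (fishburn⇒on fishburn)

  find-block : ∀ {x} → [1⋯ M ] x → (x , find x (blocks T)) ∈ blocks T
  find-block {x} x∈M with _ , e∈ ← on-label-block T-on (complete x∈M) =
    subst (λ p → (x , p) ∈ blocks T) (sym (find-∈ (on-distinct T-on) e∈)) e∈

  find⊆labels : ∀ {x y} → [1⋯ M ] x → y ∈ find x (blocks T) → y ∈ labels T
  find⊆labels x∈M y∈ =
    ∈-resp-↭ (flatten-blocks T) (∈-concat⁺′ y∈ (∈-map⁺ proj₂ (find-block x∈M)))

  row-β : ∀ i → row (β T ⟨ i ,_⟩) ↭ find (suc (toℕ i)) (blocks T)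
  row-β i = ↭-trans
    (↭-reflexive (cong concat (tabulate-cong λ j → cong (λ n → replicate n (suc (toℕ j))) (β-entry T i j))))
    (row-count (All.tabulate λ y∈ → All.lookup (on-label-bounds T-on) (find⊆labels ([1⋯]-suc-toℕ i) y∈)))

  -- The labels of a block are at most its key, no block is empty, and each label lies in some
  -- block.
  β-isFishburn : IsFishburnMatrix (β T)
  β-isFishburn = record
    { lowerTriangular = λ i j i<j → trans (β-entry T i j) (count-∉ λ j∈ →
        ℕ.<⇒≱ (s≤s i<j) (All.lookup (proj₁ (proj₂ (proj₂ (on-block T-on (find-block ([1⋯]-suc-toℕ i)))))) j∈))
    ; row≢0    = λ i → row≢0 i (find (suc (toℕ i)) (blocks T)) refl
    ; column≢0 = column≢0
    }
    where
    entry≢0 : ∀ i j → suc (toℕ j) ∈ find (suc (toℕ i)) (blocks T) → β T ⟨ i , j ⟩ ≢ 0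
    entry≢0 i j j∈ eq = count-∈ j∈ (trans (sym (β-entry T i j)) eq)
    row≢0 : ∀ i p → find (suc (toℕ i)) (blocks T) ≡ p → ∃[ j ] β T ⟨ i , j ⟩ ≢ 0
    row≢0 i [] eq = contradiction eq (proj₁ (on-block T-on (find-block ([1⋯]-suc-toℕ i))))
    row≢0 i (y ∷ _) eq
      with y∈ ← subst (y ∈_) (sym eq) (here refl)
      with j , refl ← suc-toℕ-surjective (All.lookup (on-label-bounds T-on) (find⊆labels ([1⋯]-suc-toℕ i) y∈)) =
      j , entry≢0 i j y∈
    column≢0 : ∀ j → ∃[ i ] β T ⟨ i , j ⟩ ≢ 0
    column≢0 j with _ , j∈p , p∈ ← ∈-concat⁻′ (map proj₂ (blocks T))
                      (∈-resp-↭ (↭-sym (flatten-blocks T)) (complete ([1⋯]-suc-toℕ j)))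
      with _ , e∈ , refl ← ∈-map⁻ proj₂ p∈
      with i , refl ← suc-toℕ-surjective (All.lookup (on-label-bounds T-on) (blocks-key T e∈)) =
      i , entry≢0 i j (subst (suc (toℕ j) ∈_) (sym (find-∈ (on-distinct T-on) e∈)) j∈p)

  -- Right paths are weakly decreasing, so each block equals the sorted row with the same multiset,
  -- and `assemble-unique` applies.
  tree-β : T ≡ tree (M , β T)
  tree-β = assemble-unique T-on complete (All.tabulate matches)
    where
    open Construction (matrixFamily (M , β T))
    matches : ∀ {e} → e ∈ blocks T → proj₂ e ≡ matrixFamily (M , β T) (proj₁ e)
    matches {_ , p} e∈
      with i , refl ← suc-toℕ-surjective (All.lookup (on-label-bounds T-on) (blocks-key T e∈)) =
      sorted↭⇒≡ (proj₂ (proj₂ (proj₂ (on-block T-on e∈)))) (sort-sorted _)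
        (↭-sym (↭-trans (matrixFamily-↭ (β T) i)
          (↭-trans (row-β i) (↭-reflexive (find-∈ (on-distinct T-on) e∈)))))

-- Preservation of size

length-concat : ∀ {A : Set} (xss : List (List A)) → length (concat xss) ≡ sum (map length xss)
length-concat []         = refl
length-concat (xs ∷ xss) = trans (length-++ xs) (cong (length xs +_) (length-concat xss))

length-copies : ∀ {A : Set} {k} (v : Vec ℕ k) (g : Fin k → A) → length (copies (Vec.lookup v) g) ≡ Vec.sum v
length-copies []      g = refl
length-copies (n ∷ v) g = trans
  (length-++ (replicate n (g zero)))
  (cong₂ _+_ (length-replicate n) (length-copies v (g ∘ suc)))

entrySum-rows : ∀ {k} (A : Matrix k) → entrySum A ≡ sum (tabulate λ i → length (row (A ⟨ i ,_⟩)))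
entrySum-rows {k} A = go A
  where
  -- Removing a row destroys squareness, so the number m of rows is kept apart from k.
  go : ∀ {m} (vs : Vec (Vec ℕ k) m) →
       Vec.sum (Vec.map Vec.sum vs) ≡ sum (tabulate λ i → length (row (Vec.lookup (Vec.lookup vs i))))
  go []       = refl
  go (v ∷ vs) = cong₂ _+_ (sym (length-copies v λ j → suc (toℕ j))) (go vs)

length-labels : ∀ T → length (labels T) ≡ #nodes T
length-labels empty        = refl
length-labels (node l m r) =
  trans (length-++ (labels l)) (cong₂ (λ a b → a + suc b) (length-labels l) (length-labels r))

-- Each row sums to the length of a block. Reindexing from rows to blocks by `keys↭` gives the total
-- length of the right paths, which partition the nodes.
entrySum-β : ∀ {T} → IsFishburnTree T → entrySum (β T) ≡ #nodes T
entrySum-β {T} fishburn = begin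
  entrySum (β T)
    ≡⟨ entrySum-rows (β T) ⟩
  sum (tabulate λ i → length (row (β T ⟨ i ,_⟩)))
    ≡⟨ cong sum (tabulate-cong λ i → ↭-length (row-β fishburn i)) ⟩
  sum (tabulate {n = maxLabel T} λ i → blockLength (suc (toℕ i)))
    ≡⟨ cong sum (map-tabulate {n = maxLabel T} (suc ∘ toℕ) blockLength) ⟨
  sum (map blockLength (tabulate {n = maxLabel T} (suc ∘ toℕ)))
    ≡⟨ sum-↭ (↭.map⁺ blockLength (keys↭ T-on complete)) ⟩
  sum (map blockLength (map proj₁ (blocks T)))
    ≡⟨ cong sum (map-∘ (blocks T)) ⟨
  sum (map (blockLength ∘ proj₁) (blocks T))
    ≡⟨ cong sum (map-cong-local (All.tabulate λ e∈ → cong length (find-∈ (on-distinct T-on) e∈))) ⟩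
  sum (map (length ∘ proj₂) (blocks T))
    ≡⟨ cong sum (map-∘ (blocks T)) ⟩
  sum (map length (map proj₂ (blocks T)))
    ≡⟨ length-concat (map proj₂ (blocks T)) ⟨
  length (flatten (blocks T))
    ≡⟨ ↭-length (flatten-blocks T) ⟩
  length (labels T)
    ≡⟨ length-labels T ⟩
  #nodes T ∎
  where
  open ≡-Reasoning
  T-on     = proj₁ (fishburn⇒on fishburn)
  complete = proj₂ (fishburn⇒on fishburn)
  blockLength : ℕ → ℕ
  blockLength x = length (find x (blocks T))

-- The bijection and its restriction to each size

β̂ : FishburnTree → FishburnMatrix
β̂ (T , fishburn) = (maxLabel T , β T) , β-isFishburn fishburn

β̄ : FishburnMatrix → FishburnTree
β̄ (A , fishburn) = tree A , tree-isFishburn fishburn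

-- The multisets of T determine `β T`, from which `tree-β` recovers T.
isβ̄-unique : ∀ A T → Isβ̄ A T → proj₁ T ≡ proj₁ (β̄ A)
isβ̄-unique ((_ , A) , _) (T , fishburn) isβ̄ = trans (tree-β fishburn) (cong tree (isβ̄⇒β≡ T {A = A} isβ̄))

β̂∘β̄ : ∀ A → proj₁ (β̂ (β̄ A)) ≡ proj₁ A
β̂∘β̄ ((_ , A) , fishburn) = isβ̄⇒β≡ (tree (_ , A)) {A = A} (tree-isβ̄ fishburn)

treeSize-β̄ : ∀ A → treeSize (β̄ A) ≡ matrixSize A
treeSize-β̄ A = trans (sym (entrySum-β (proj₂ (β̄ A)))) (cong (entrySum ∘ proj₂) (β̂∘β̄ A))

β↔β̄ : Inverse 𝒯 ℳ
β↔β̄ = record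
  { to        = β̂
  ; from      = β̄
  ; to-cong   = cong (λ T → maxLabel T , β T)
  ; from-cong = cong tree
  ; inverse   = (λ {A} eq → trans (cong (λ T → maxLabel T , β T) eq) (β̂∘β̄ A)) ,
                (λ {(_ , fishburn)} eq → trans (cong tree eq) (sym (tree-β fishburn)))
  }

𝒯↔ℳ[_] : ∀ n → Inverse 𝒯[ n ] ℳ[ n ]
𝒯↔ℳ[ n ] = record
  { to        = λ ((T , fishburn) , eq) → β̂ (T , fishburn) , trans (entrySum-β fishburn) eq
  ; from      = λ (A , eq) → β̄ A , trans (treeSize-β̄ A) eq
  ; to-cong   = cong (λ T → maxLabel T , β T)
  ; from-cong = cong tree
  ; inverse   = (λ {(A , _)} {T} → proj₁ (Inverse.inverse β↔β̄) {A} {proj₁ T}) ,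
                (λ {(T , _)} {A} → proj₂ (Inverse.inverse β↔β̄) {T} {proj₁ A})
  }

-- Counting

lookup-injective : ∀ {A : Set} {xs : List A} → Unique xs → ∀ i j → lookup xs i ≡ lookup xs j → i ≡ j
lookup-injective (x≢ ∷ u) zero    zero    eq = refl
lookup-injective (x≢ ∷ u) zero    (suc j) eq = contradiction eq (All.lookup x≢ (∈-lookup j))
lookup-injective (x≢ ∷ u) (suc i) zero    eq = contradiction (sym eq) (All.lookup x≢ (∈-lookup i))
lookup-injective (x≢ ∷ u) (suc i) (suc j) eq = cong suc (lookup-injective u i j eq)

-- Elements of A carry proofs that setoid equality ignores, so the counting takes place in X, where
-- P is a decidable description of the image of f. Removing duplicates from the candidates makes the
-- index of an element unique.
module _ {A X : Set} (f : A → X) {P : X → Set} (_≟ˣ_ : DecidableEquality X) (P? : Decidable P)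
         (P-image : ∀ a → P (f a)) (preimage : ∀ x → P x → ∃[ a ] f a ≡ x)
         (candidates : List X) (exhaustive : ∀ x → P x → x ∈ candidates) where

  private
    xs : List X
    xs = deduplicate _≟ˣ_ (filter P? candidates)

    f∈xs : ∀ a → f a ∈ xs
    f∈xs a = ∈-deduplicate⁺ _≟ˣ_ (∈-filter⁺ P? (exhaustive (f a) (P-image a)) (P-image a))

    choose : ∀ i → ∃[ a ] f a ≡ lookup xs i
    choose i = preimage (lookup xs i)
      (proj₂ (∈-filter⁻ P? {xs = candidates} (∈-deduplicate⁻ _≟ˣ_ (filter P? candidates) (∈-lookup i))))

    index : A → Fin (length xs)
    index a = Any.index (f∈xs a)

    index-unique : ∀ {a i} → f a ≡ lookup xs i → index a ≡ i
    index-unique {a} {i} eq = lookup-injective (deduplicate-! _≟ˣ_ (filter P? candidates)) (index a) i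
      (trans (sym (lookup-index (f∈xs a))) eq)

  finite : ∃[ c ] ∣ On.setoid (≡.setoid X) f ∣≡ c
  finite = length xs , record
    { to        = index
    ; from      = λ i → proj₁ (choose i)
    ; to-cong   = λ {_} {b} eq → index-unique (trans eq (lookup-index (f∈xs b)))
    ; from-cong = cong (λ i → f (proj₁ (choose i)))
    ; inverse   = (λ {i} eq → index-unique (trans eq (proj₂ (choose i)))) ,
                  (λ { {a} refl → trans (proj₂ (choose (index a))) (sym (lookup-index (f∈xs a))) })
    }

isFishburnMatrix? : ∀ {k} (A : Matrix k) → Dec (IsFishburnMatrix A)
isFishburnMatrix? A = map′
  (λ (lower , row≢0 , column≢0) → record { lowerTriangular = lower ; row≢0 = row≢0 ; column≢0 = column≢0 })
  (λ fishburn → let open IsFishburnMatrix fishburn in lowerTriangular , row≢0 , column≢0)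
  (Fin.all? (λ i → Fin.all? λ j → (i Fin.<? j) →-dec (A ⟨ i , j ⟩ ℕ.≟ 0)) ×-dec
   Fin.all? (λ i → Fin.any? λ j → ¬? (A ⟨ i , j ⟩ ℕ.≟ 0)) ×-dec
   Fin.all? (λ j → Fin.any? λ i → ¬? (A ⟨ i , j ⟩ ℕ.≟ 0)))

vectors : ∀ {A : Set} → List A → ∀ k → List (Vec A k)
vectors xs zero    = [] ∷ []
vectors xs (suc k) = cartesianProductWith _∷_ xs (vectors xs k)

∈-vectors : ∀ {A : Set} {xs : List A} {k} (v : Vec A k) → (∀ i → Vec.lookup v i ∈ xs) → v ∈ vectors xs k
∈-vectors []      _  = here refl
∈-vectors (x ∷ v) ∈xs = ∈-cartesianProductWith⁺ _∷_ (∈xs zero) (∈-vectors v (∈xs ∘ suc))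

lookup≤sum : ∀ {k} (v : Vec ℕ k) i → Vec.lookup v i ≤ Vec.sum v
lookup≤sum (n ∷ v) zero    = ℕ.m≤m+n n (Vec.sum v)
lookup≤sum (n ∷ v) (suc i) = ≤-trans (lookup≤sum v i) (ℕ.m≤n+m (Vec.sum v) n)

entry≤entrySum : ∀ {k} (A : Matrix k) i j → A ⟨ i , j ⟩ ≤ entrySum A
entry≤entrySum A i j = ≤-trans (lookup≤sum (Vec.lookup A i) j)
  (subst (_≤ entrySum A) (Vec.lookup-map i Vec.sum A) (lookup≤sum (Vec.map Vec.sum A) i))

-- Each of the k rows contributes at least one to the sum.
dimension≤entrySum : ∀ {k} {A : Matrix k} → IsFishburnMatrix A → k ≤ entrySum A
dimension≤entrySum {k} {A} fishburn = go A (IsFishburnMatrix.row≢0 fishburn)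
  where
  go : ∀ {m} (vs : Vec (Vec ℕ k) m) → (∀ i → ∃[ j ] Vec.lookup (Vec.lookup vs i) j ≢ 0) →
       m ≤ Vec.sum (Vec.map Vec.sum vs)
  go []       _   = z≤n
  go (v ∷ vs) ≢0 with j , v≢0 ← ≢0 zero =
    ℕ.+-mono-≤ (≤-trans (ℕ.n≢0⇒n>0 v≢0) (lookup≤sum v j)) (go vs (≢0 ∘ suc))

squares : ℕ → ℕ → List (∃ Matrix)
squares n k = map (k ,_) (vectors (vectors (upTo (suc n)) k) k)

-- The dimension and all entries of a Fishburn matrix of size n are at most n; the surplus matrices
-- are filtered out in `finite`.
matrices : ℕ → List (∃ Matrix)
matrices n = concatMap (squares n) (upTo (suc n))

∈-matrices : ∀ {n} A → IsFishburnMatrix (proj₂ A) × entrySum (proj₂ A) ≡ n → A ∈ matrices n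
∈-matrices (k , A) (fishburn , refl) = ∈-concat⁺′
  (∈-map⁺ (k ,_) (∈-vectors A λ i → ∈-vectors (Vec.lookup A i) λ j → ∈-upTo⁺ (s≤s (entry≤entrySum A i j))))
  (∈-map⁺ (squares (entrySum A)) (∈-upTo⁺ (s≤s (dimension≤entrySum fishburn))))

ℳ-finite : ∀ n → ∃[ c ] ∣ ℳ[ n ] ∣≡ c
ℳ-finite n = finite {A = Setoid.Carrier ℳ[ n ]} (λ (A , _) → proj₁ A)
  (Product.≡-dec ℕ._≟_ (Vec.≡-dec (Vec.≡-dec ℕ._≟_)))
  (λ (_ , A) → isFishburnMatrix? A ×-dec (entrySum A ℕ.≟ n))
  (λ ((_ , fishburn) , eq) → fishburn , eq)
  (λ A (fishburn , eq) → ((A , fishburn) , eq) , refl)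
  (matrices n) ∈-matrices

corollary5p2 :
    (Σ[ β↔β̄ ∈ Inverse 𝒯 ℳ ]
      let β̂ = Inverse.to β↔β̄
          β̄ = Inverse.from β↔β̄
      in
        (∀ T → proj₁ (β̂ T) ≡ (maxLabel (proj₁ T) , β (proj₁ T)))
      × (∀ A → Isβ̄ A (β̄ A) × (∀ T → Isβ̄ A T → Setoid._≈_ 𝒯 T (β̄ A)))
      × (∀ T → matrixSize (β̂ T) ≡ treeSize T)
      × (∀ A → treeSize (β̄ A) ≡ matrixSize A))
    × (∀ n → 1 ≤ n → ∃[ c ] (∣ 𝒯[ n ] ∣≡ c × ∣ ℳ[ n ] ∣≡ c))
corollary5p2 =
  (β↔β̄ ,
    (λ _ → refl) ,
    (λ A → tree-isβ̄ (proj₂ A) , isβ̄-unique A) ,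
    (λ (_ , fishburn) → entrySum-β fishburn) ,
    treeSize-β̄) ,
  -- Only matrices are enumerated; the trees of size n get the same number through the
  -- size-preserving bijection.
  λ n _ → let c , ℳ≅c = ℳ-finite n in c , Composition.inverse 𝒯↔ℳ[ n ] ℳ≅c , ℳ≅c
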